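{- Let the theory be linear integer arithmetic $\mathsf{LIA}$. Then the synthesis problem is solvable for well-formed IPC properties. That is, for such properties: - realizability is decidable (via computing and checking satisfiability of the fixpoint $\mathit{Win}(\mathcal{AO}_\psi)$); - the strategy $g$ realizes every realizable such property.
   Context: Syntax. Properties are built over $\mathsf{LIA}$ with a finite non-empty set $V$ of integer variables. Each $v\in V$ has a lookback variable $\overleftarrow v$ (the value of $v$ at the previous instant). First-order formulas are $\phi::=\top\mid\bot\mid a\mid\neg a\mid\phi\wedge\phi\mid\phi\vee\phi$. Properties are $\psi::=\phi\mid\psi\wedge\psi\mid\psi\vee\psi\mid\mathsf X\psi\mid\mathsf X_{\mathsf w}\psi\mid\psi\mathsf U\psi\mid\psi\mathsf R\psi$. An IPC property is one all of whose atoms are integer periodicity constraints: $x=y$; $x\odot d$ with $\odot\in\{=,\neq,<,>\}$; $x\equiv_k y+d$; or $x\equiv_k d$. Here $x,y$ are integer variables (possibly lookback variables), $k,d\in\mathbb N$, and $\equiv_k$ is congruence modulo $k$. Semantics. Over a trace $\langle\alpha_0,\dots,\alpha_{n-1}\rangle$ of integer assignments to $V$, at instant $i$: - $v$ denotes $\alpha_i(v)$, and $\overleftarrow v$ denotes $\alpha_{i-1}(v)$. - Atoms with lookback variables hold at instant $0$; otherwise atoms are evaluated as usual, and $\neg a$ holds iff $a$ does not. - $\mathsf X\psi$: $i<n-1$ and $\psi$ holds at $i+1$. - $\mathsf X_{\mathsf w}\psi$: $i=n-1$ or $\psi$ holds at $i+1$. - $\psi_1\mathsf U\psi_2$: some $j\in[i,n)$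 has $\psi_2$, with $\psi_1$ on $[i,j)$. - $\psi_1\mathsf R\psi_2$: $\psi_2$ holds on $[i,n)$, or some $j\in[i,n)$ has $\psi_1$ with $\psi_2$ on $[i,j]$. A trace satisfies $\psi$ if $\psi$ holds at $0$. Normal forms and decomposition. - $\mathit{last}$ is a proposition holding at the last instant. - $\mathsf{tnps}(\psi)=\{\psi\}$ for (negated) atoms and temporally-rooted $\psi$, and is the union over $\wedge$ and $\vee$. - $\mathsf{xnf}$ fixes literals, $\top$, $\bot$ and $\mathsf X$/$\mathsf X_{\mathsf w}$-rooted properties, commutes with $\wedge$ and $\vee$, and satisfies $\mathsf{xnf}(\psi_1\mathsf U\psi_2)=\mathsf{xnf}(\psi_2)\vee(\mathsf{xnf}(\psi_1)\wedge\mathsf X(\psi_1\mathsf U\psi_2))$ and $\mathsf{xnf}(\psi_1\mathsf R\psi_2)=(\mathsf{xnf}(\psi_2)\vee\mathit{last})\wedge(\mathsf{xnf}(\psi_1)\vee\mathsf X_{\mathsf w}(\psi_1\mathsf R\psi_2))$. - $\psi$ is well-formed if no (negated) atom in $\mathsf{tnps}(\mathsf{xnf}(\psi))$ contains a lookback variable. - $\mathsf{rmX}$ maps $\bot,\top,\mathit{last},\neg\mathit{last}$ to $\bot,\top,\bot,\top$, maps $\mathsf X\psi\mapsto\psi\wedge\neg\mathit{last}$ and $\mathsf X_{\mathsf w}\psi\mapsto\psi\vee\mathit{last}$, and commutes with $\wedge$ and $\vee$. - $\equiv$ is propositional equivalence with atoms, $\mathit{last}$ and temporally-rooted subproperties opaque.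 - For $\psi$ in XNF and atom set $C$, $\mathsf{decomp}(\psi,C)=\{(\mathsf{prm}_i,\mathsf{sub}_i)\}_{i\le k}$ is a fixed decomposition with: $\psi\equiv\bigvee_i(\mathsf{prm}_i\wedge\mathsf{sub}_i)$; $\mathsf{prm}_i$ temporal-free over atoms in $C$; $\mathsf{tnps}(\mathsf{sub}_i)\cap C=\emptyset$; the $\mathsf{prm}_i$ pairwise disjoint and covering; the $\mathsf{sub}_i$ pairwise distinct. AND-OR-graph. $V=X\uplus Y$, with $X$ the environment variables and $Y$ the agent variables. $C_{\mathit{env}}$ is the set of atoms of $\psi$ without $Y$-variables, and $C_{\mathit{ag}}$ is the rest. $\mathcal{AO}_\psi$ is built as follows: - The initial AND-node $s_0$ is labelled $\psi$. - Each AND-node labelled $\psi'\ne\top$ has, for each $(\mathsf{prm}_i,\mathsf{sub}_i)\in\mathsf{decomp}(\mathsf{xnf}(\psi'),C_{\mathit{env}})$, an edge labelled $\mathsf{prm}_i$ to an OR-node $n_i$. - $n_i$ has, for each $(\mathsf{prm}_{i,j},\mathsf{sub}_{i,j})\in\mathsf{decomp}(\mathsf{xnf}(\mathsf{sub}_i),C_{\mathit{ag}})$, an edge labelled $\mathsf{prm}_{i,j}$ to the AND-node labelled $\mathsf{xnf}(\mathsf{rmX}(\mathsf{sub}_{i,j}))$. - Equal labels are shared; the node labelled $\top$ is final. Winning formulas. - For an OR-node $t$ with edges $t\xrightarrow{\varsigma_j}s_j$: $\mathit{Pre}'_{\mathcal C}(t)=\bigvee_j\exists Y.(\varsigma_j\wedge\mathcal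 C(s_j))$. - For an AND-node $s$ with edges $s\xrightarrow{w_i}t_i$: $\mathit{Pre}_{\mathcal C}(s)=\bigwedge_i(\forall X.(w_i\to\mathit{Pre}'_{\mathcal C}(t_i)))[\overleftarrow V/V]$, renaming $\overleftarrow v$ to $v$. - $\mathit{Win}_0(s)=\top$ iff $s$ is final, and $\bot$ otherwise; $\mathit{Win}_{i+1}(s)=\mathit{Win}_i(s)\vee\mathit{Pre}_{\mathit{Win}_i}(s)$. - $\mathit{Win}(\mathcal{AO}_\psi)=\bigvee_i\mathit{Win}_i(s_0)$, defined when $\mathit{Win}_K(s_0)=\mathit{Win}_{K+1}(s_0)$ for some $K$. Synthesis. The environment chooses $\beta_0,\beta_1,\ldots$ (assignments on $X$). A strategy $h:[X]^*\to[Y]$ realizes $\psi$ if for every $\pi=\beta_0\beta_1\cdots$ there is $k$ with $\langle\beta_0\cup h(\pi|_1),\dots,\beta_k\cup h(\pi|_{k+1})\rangle\models\psi$, where $\pi|_k$ is the prefix of length $k$. Strategy $g$. Assume $\mathit{Win}_K(s_0)=\mathit{Win}_{K+1}(s_0)$ and that it is satisfiable. Inductively: - $\eta_0=\beta_0$; for $k>0$, $\eta_k=\beta_k\cup\overleftarrow\beta_{k-1}\cup\overleftarrow\gamma_{k-1}$ with $\gamma_{k-1}=g(\pi|_k)$. - Take the unique edge $s_k\xrightarrow{w}t$ with $\eta_k\models w$ (starting at $s_0$). - Choose $t\xrightarrow{\varsigma_j}u_j$ such that $\eta_k(\varsigma_j\wedge\mathit{Win}_{K-k}(u_j))$ is satisfiable;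 let $g(\pi|_{k+1})$ satisfy it and set $s_{k+1}=u_j$. - Stop at a final node. Solvable. Realizability is decidable for the class and $g$ realizes every realizable member.
   Formalization: A node is final when its label becomes ⊤ once last is true, not only when labelled ⊤: otherwise X_w(x>0) with x an environment variable is realizable but Win is unsatisfiable. Moduli k are positive: ≡_0 would give x=y+d, making realizability undecidable. -}

module Defs where

open import Data.Bool.Base using (Bool; true; false; not; if_then_else_) renaming (_∧_ to _∧ᵇ_; _∨_ to _∨ᵇ_)
import Data.Bool.Properties as Bool
open import Data.Empty using (⊥)
open import Data.Fin.Base using (Fin)
import Data.Fin.Properties as Fin
open import Data.Integer.Base using (ℤ; +_; _-_; _<_; _>_) renaming (_+_ to _+ℤ_)
open import Data.Integer.Divisibility using (_∣_)
open import Data.List.Base using (List; []; _∷_; _++_; map; foldr; filter; applyUpTo)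
open import Data.List.Membership.Propositional using (_∈_; _∉_)
open import Data.List.Membership.Propositional.Properties using (∈-++⁺ˡ; ∈-++⁺ʳ)
open import Data.List.Relation.Unary.All using (All)
open import Data.List.Relation.Unary.AllPairs using (AllPairs)
open import Data.List.Relation.Unary.Any using (Any; any?; here; there)
open import Data.Maybe.Base using (Maybe; just; nothing)
import Data.Maybe.Properties as Maybe
open import Data.Nat.Base as ℕ using (ℕ; zero; suc; _∸_; NonZero)
import Data.Nat.Properties as ℕ
open import Data.Product.Base using (Σ-syntax; ∃-syntax; _×_; _,_; proj₁; proj₂)
import Data.Product.Properties as Product
open import Data.Sum.Base using (_⊎_; inj₁; inj₂)
import Data.Sum.Properties as Sum
open import Data.Unit.Base using (⊤; tt)
open import Data.Vec.Base using (Vec; lookup)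
open import Function.Base using (_∘_)
open import Function.Bundles using (_⇔_)
open import Relation.Binary.Definitions using (DecidableEquality)
open import Relation.Binary.PropositionalEquality
open import Relation.Nullary using (¬_; Dec; yes; no; does; contradiction)
open import Relation.Nullary.Decidable using (¬?; map′)

data Cmp : Set where
  EQ NE LT GT : Cmp

-- Moduli are positive: congruence modulo 0 would make x ≡₀ y + d the
-- constraint x = y + d.
data IPC (Γ : Set) : Set where
  eqVar   : Γ → Γ → IPC Γ
  cmp     : Γ → Cmp → ℕ → IPC Γ
  congVar : Γ → (k : ℕ) .{{_ : NonZero k}} → Γ → ℕ → IPC Γ
  congNum : Γ → (k : ℕ) .{{_ : NonZero k}} → ℕ → IPC Γ

⟦_⟧ᶜ : Cmp → ℤ → ℤ → Set
⟦ EQ ⟧ᶜ i j = i ≡ j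
⟦ NE ⟧ᶜ i j = i ≢ j
⟦ LT ⟧ᶜ i j = i < j
⟦ GT ⟧ᶜ i j = i > j

⟦_⟧ᵃ : ∀ {Γ} → IPC Γ → (Γ → ℤ) → Set
⟦ eqVar x y       ⟧ᵃ ρ = ρ x ≡ ρ y
⟦ cmp x c d       ⟧ᵃ ρ = ⟦ c ⟧ᶜ (ρ x) (+ d)
⟦ congVar x k y d ⟧ᵃ ρ = + k ∣ (ρ x - (ρ y +ℤ + d))
⟦ congNum x k d   ⟧ᵃ ρ = + k ∣ (ρ x - + d)

vars : ∀ {Γ} → IPC Γ → List Γ
vars (eqVar x y)       = x ∷ y ∷ []
vars (cmp x _ _)       = x ∷ []
vars (congVar x _ y _) = x ∷ y ∷ []
vars (congNum x _ _)   = x ∷ []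

mapᵃ : ∀ {Γ Δ} → (Γ → Δ) → IPC Γ → IPC Δ
mapᵃ f (eqVar x y)       = eqVar (f x) (f y)
mapᵃ f (cmp x c d)       = cmp (f x) c d
mapᵃ f (congVar x k y d) = congVar (f x) k (f y) d
mapᵃ f (congNum x k d)   = congNum (f x) k d

data FO (A : Set) : Set where
  const   : Bool → FO A
  lit     : Bool → A → FO A
  _∧_ _∨_ : FO A → FO A → FO A

data UnOp : Set where
  nextOp wnextOp : UnOp

data BinOp : Set where
  andOp orOp untilOp releaseOp : BinOp

data Property (A : Set) : Set where
  const : Bool → Property A
  lit   : Bool → A → Property A
  un    : UnOp → Property A → Property A
  bin   : BinOp → Property A → Property A → Property A

infixr 6 _∧_ _∧ᵖ_
infixr 5 _∨_ _∨ᵖ_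
infix 7 _𝖴_ _𝖱_

pattern ⊤ᵖ       = const true
pattern ⊥ᵖ       = const false
pattern atomᵖ a  = lit true a
pattern ¬ᵖ a     = lit false a
pattern _∧ᵖ_ φ ψ = bin andOp φ ψ
pattern _∨ᵖ_ φ ψ = bin orOp φ ψ
pattern 𝖷 ψ      = un nextOp ψ
pattern 𝖷ʷ ψ     = un wnextOp ψ
pattern _𝖴_ φ ψ  = bin untilOp φ ψ
pattern _𝖱_ φ ψ  = bin releaseOp φ ψ

⟦_⟧ᶠ : ∀ {A} → FO A → (A → Set) → Set
⟦ const true  ⟧ᶠ I = ⊤
⟦ const false ⟧ᶠ I = ⊥
⟦ lit true a  ⟧ᶠ I = I a
⟦ lit false a ⟧ᶠ I = ¬ I a
⟦ φ ∧ χ       ⟧ᶠ I = ⟦ φ ⟧ᶠ I × ⟦ χ ⟧ᶠ I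
⟦ φ ∨ χ       ⟧ᶠ I = ⟦ φ ⟧ᶠ I ⊎ ⟦ χ ⟧ᶠ I

mapᶠ : ∀ {A B} → (A → B) → FO A → FO B
mapᶠ f (const b) = const b
mapᶠ f (lit b a) = lit b (f a)
mapᶠ f (φ ∧ χ)   = mapᶠ f φ ∧ mapᶠ f χ
mapᶠ f (φ ∨ χ)   = mapᶠ f φ ∨ mapᶠ f χ

atomsᶠ : ∀ {A} → FO A → List A
atomsᶠ (const _) = []
atomsᶠ (lit _ a) = a ∷ []
atomsᶠ (φ ∧ χ)   = atomsᶠ φ ++ atomsᶠ χ
atomsᶠ (φ ∨ χ)   = atomsᶠ φ ++ atomsᶠ χ

mapᵖ : ∀ {A B} → (A → B) → Property A → Property B
mapᵖ f (const b)   = const b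
mapᵖ f (lit b a)   = lit b (f a)
mapᵖ f (un o ψ)    = un o (mapᵖ f ψ)
mapᵖ f (bin o φ ψ) = bin o (mapᵖ f φ) (mapᵖ f ψ)

atomsᵖ : ∀ {A} → Property A → List A
atomsᵖ (const _)   = []
atomsᵖ (lit _ a)   = a ∷ []
atomsᵖ (un _ ψ)    = atomsᵖ ψ
atomsᵖ (bin _ φ ψ) = atomsᵖ φ ++ atomsᵖ ψ

⌈_⌉ : ∀ {A} → FO A → Property A
⌈ const b ⌉ = const b
⌈ lit b a ⌉ = lit b a
⌈ φ ∧ χ ⌉   = ⌈ φ ⌉ ∧ᵖ ⌈ χ ⌉
⌈ φ ∨ χ ⌉   = ⌈ φ ⌉ ∨ᵖ ⌈ χ ⌉

⋁ᵖ : ∀ {A} → List (Property A) → Property A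
⋁ᵖ = foldr _∨ᵖ_ ⊥ᵖ

-- V = X ⊎ Y with m environment and n agent variables.
V : ℕ → ℕ → Set
V m n = Fin m ⊎ Fin n

Var : ℕ → ℕ → Set
Var m n = V m n ⊎ V m n

pattern now v    = inj₁ v
pattern before v = inj₂ v

IsLookback : ∀ {m n} → Var m n → Set
IsLookback (now _)    = ⊥
IsLookback (before _) = ⊤

-- The lookback variables of Y do not count as Y-variables.
IsAgent : ∀ {m n} → Var m n → Set
IsAgent (now (inj₁ _)) = ⊥
IsAgent (now (inj₂ _)) = ⊤
IsAgent (before _)     = ⊥

isAgent? : ∀ {m n} (z : Var m n) → Dec (IsAgent z)
isAgent? (now (inj₁ _)) = no λ ()
isAgent? (now (inj₂ _)) = yes tt
isAgent? (before _)     = no λ ()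

HasLookback HasAgent : ∀ {m n} → IPC (Var m n) → Set
HasLookback a = Any IsLookback (vars a)
HasAgent a    = Any IsAgent (vars a)

-- nothing is the proposition last.
Atom⁺ : ℕ → ℕ → Set
Atom⁺ m n = Maybe (IPC (Var m n))

pattern last = nothing

IPCProperty Label : ℕ → ℕ → Set
IPCProperty m n = Property (IPC (Var m n))
Label m n       = Property (Atom⁺ m n)

embed : ∀ {m n} → IPCProperty m n → Label m n
embed = mapᵖ just

Assignment : ℕ → ℕ → Set
Assignment m n = Vec ℤ m × Vec ℤ n

value : ∀ {m n} → Assignment m n → V m n → ℤ
value (β , γ) (inj₁ x) = lookup β x
value (β , γ) (inj₂ y) = lookup γ y

env : ∀ {m n} → Assignment m n → Assignment m n → Var m n → ℤ
env α⁻ α (now v)    = value α v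
env α⁻ α (before v) = value α⁻ v

-- The first argument is the assignment at the previous instant, if any.
-- In the first clause the values given to lookback variables are immaterial.
holds : ∀ {m n} → Maybe (Assignment m n) → Assignment m n → IPC (Var m n) → Set
holds nothing   α a = HasLookback a ⊎ ⟦ a ⟧ᵃ (env α α)
holds (just α⁻) α a = ⟦ a ⟧ᵃ (env α⁻ α)

previous : ∀ {A : Set} → (ℕ → A) → ℕ → Maybe A
previous σ zero    = nothing
previous σ (suc i) = just (σ i)

-- N , σ , i ⊨ ψ : the trace ⟨σ 0, …, σ (N - 1)⟩ satisfies ψ at instant i.
_,_,_⊨_ : ∀ {m n} → ℕ → (ℕ → Assignment m n) → ℕ → IPCProperty m n → Set
N , σ , i ⊨ ⊤ᵖ       = ⊤
N , σ , i ⊨ ⊥ᵖ       = ⊥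
N , σ , i ⊨ atomᵖ a  = holds (previous σ i) (σ i) a
N , σ , i ⊨ ¬ᵖ a     = ¬ holds (previous σ i) (σ i) a
N , σ , i ⊨ (φ ∧ᵖ ψ) = (N , σ , i ⊨ φ) × (N , σ , i ⊨ ψ)
N , σ , i ⊨ (φ ∨ᵖ ψ) = (N , σ , i ⊨ φ) ⊎ (N , σ , i ⊨ ψ)
N , σ , i ⊨ 𝖷 ψ      = suc i ℕ.< N × (N , σ , suc i ⊨ ψ)
N , σ , i ⊨ 𝖷ʷ ψ     = suc i ≡ N ⊎ (N , σ , suc i ⊨ ψ)
N , σ , i ⊨ (φ 𝖴 ψ)  =
  ∃[ j ] (i ℕ.≤ j) × (j ℕ.< N) × (N , σ , j ⊨ ψ) ×
         (∀ l → i ℕ.≤ l → l ℕ.< j → N , σ , l ⊨ φ)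
N , σ , i ⊨ (φ 𝖱 ψ)  =
  (∀ j → i ℕ.≤ j → j ℕ.< N → N , σ , j ⊨ ψ) ⊎
  (∃[ j ] (i ℕ.≤ j) × (j ℕ.< N) × (N , σ , j ⊨ φ) ×
          (∀ l → i ℕ.≤ l → l ℕ.≤ j → N , σ , l ⊨ ψ))

prefix : ∀ {A : Set} → (ℕ → A) → ℕ → List A
prefix = applyUpTo

play : ∀ {m n} → (List (Vec ℤ m) → Vec ℤ n) → (ℕ → Vec ℤ m) → ℕ → Assignment m n
play h π i = π i , h (prefix π (suc i))

Realizes : ∀ {m n} → (List (Vec ℤ m) → Vec ℤ n) → IPCProperty m n → Set
Realizes h ψ = ∀ π → ∃[ k ] (suc k , play h π , 0 ⊨ ψ)

Realizable : ∀ {m n} → IPCProperty m n → Set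
Realizable ψ = ∃[ h ] Realizes h ψ

tnps : ∀ {A} → Property A → List (Property A)
tnps (const _) = []
tnps (φ ∧ᵖ ψ)  = tnps φ ++ tnps ψ
tnps (φ ∨ᵖ ψ)  = tnps φ ++ tnps ψ
tnps ψ         = ψ ∷ []

xnf : ∀ {m n} → Label m n → Label m n
xnf (const b)  = const b
xnf (lit b a)  = lit b a
xnf (un o ψ)   = un o ψ
xnf (φ ∧ᵖ ψ)   = xnf φ ∧ᵖ xnf ψ
xnf (φ ∨ᵖ ψ)   = xnf φ ∨ᵖ xnf ψ
xnf (φ 𝖴 ψ)    = xnf ψ ∨ᵖ (xnf φ ∧ᵖ 𝖷 (φ 𝖴 ψ))
xnf (φ 𝖱 ψ)    = (xnf ψ ∨ᵖ atomᵖ last) ∧ᵖ (xnf φ ∨ᵖ 𝖷ʷ (φ 𝖱 ψ))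

XNF : ∀ {A} → Property A → Set
XNF (const _) = ⊤
XNF (lit _ _) = ⊤
XNF (un _ _)  = ⊤
XNF (φ ∧ᵖ ψ)  = XNF φ × XNF ψ
XNF (φ ∨ᵖ ψ)  = XNF φ × XNF ψ
XNF (_ 𝖴 _)   = ⊥
XNF (_ 𝖱 _)   = ⊥

-- rmX is only meant for labels whose remaining atoms are last; it is
-- extended to all labels by fixing other literals and 𝖴/𝖱-rooted labels.
rmX : ∀ {m n} → Label m n → Label m n
rmX (atomᵖ last) = ⊥ᵖ
rmX (¬ᵖ last)    = ⊤ᵖ
rmX (𝖷 ψ)        = ψ ∧ᵖ ¬ᵖ last
rmX (𝖷ʷ ψ)       = ψ ∨ᵖ atomᵖ last
rmX (φ ∧ᵖ ψ)     = rmX φ ∧ᵖ rmX ψ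
rmX (φ ∨ᵖ ψ)     = rmX φ ∨ᵖ rmX ψ
rmX ψ            = ψ

LookbackFreeLiteral : ∀ {m n} → Label m n → Set
LookbackFreeLiteral (lit _ (just a)) = ¬ HasLookback a
LookbackFreeLiteral _                = ⊤

WellFormed : ∀ {m n} → IPCProperty m n → Set
WellFormed ψ = All LookbackFreeLiteral (tnps (xnf (embed ψ)))

-- A valuation is consulted only at atoms, last and temporally rooted labels.
evalᵖ : ∀ {A} → (Property A → Bool) → Property A → Bool
evalᵖ v (const b) = b
evalᵖ v (atomᵖ a) = v (atomᵖ a)
evalᵖ v (¬ᵖ a)    = not (v (atomᵖ a))
evalᵖ v (φ ∧ᵖ ψ)  = evalᵖ v φ ∧ᵇ evalᵖ v ψ
evalᵖ v (φ ∨ᵖ ψ)  = evalᵖ v φ ∨ᵇ evalᵖ v ψ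
evalᵖ v (un o ψ)  = v (un o ψ)
evalᵖ v (φ 𝖴 ψ)   = v (φ 𝖴 ψ)
evalᵖ v (φ 𝖱 ψ)   = v (φ 𝖱 ψ)

infix 4 _≈_
_≈_ : ∀ {A} → Property A → Property A → Set
φ ≈ ψ = ∀ v → evalᵖ v φ ≡ evalᵖ v ψ

module Decide {A : Set} (_≟ᴬ_ : DecidableEquality A) where

  _≟ᵘ_ : DecidableEquality UnOp
  nextOp  ≟ᵘ nextOp  = yes refl
  nextOp  ≟ᵘ wnextOp = no λ ()
  wnextOp ≟ᵘ nextOp  = no λ ()
  wnextOp ≟ᵘ wnextOp = yes refl

  binCode : BinOp → Bool × Bool
  binCode andOp     = false , false
  binCode orOp      = false , true
  binCode untilOp   = true , false
  binCode releaseOp = true , true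

  binOp : Bool × Bool → BinOp
  binOp (false , false) = andOp
  binOp (false , true)  = orOp
  binOp (true , false)  = untilOp
  binOp (true , true)   = releaseOp

  binOp-binCode : ∀ o → binOp (binCode o) ≡ o
  binOp-binCode andOp     = refl
  binOp-binCode orOp      = refl
  binOp-binCode untilOp   = refl
  binOp-binCode releaseOp = refl

  _≟ᵇ_ : DecidableEquality BinOp
  o ≟ᵇ o′ = map′
    (λ e → trans (sym (binOp-binCode o)) (trans (cong binOp e) (binOp-binCode o′)))
    (cong binCode)
    (Product.≡-dec Bool._≟_ Bool._≟_ (binCode o) (binCode o′))

  _≟_ : DecidableEquality (Property A)
  const b ≟ const b′ = map′ (cong const) (λ { refl → refl }) (b Bool.≟ b′)
  lit b a ≟ lit b′ a′ with b Bool.≟ b′ | a ≟ᴬ a′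
  ... | yes refl | yes refl = yes refl
  ... | no b≢    | _        = no λ { refl → b≢ refl }
  ... | yes _    | no a≢    = no λ { refl → a≢ refl }
  un o ψ ≟ un o′ ψ′ with o ≟ᵘ o′ | ψ ≟ ψ′
  ... | yes refl | yes refl = yes refl
  ... | no o≢    | _        = no λ { refl → o≢ refl }
  ... | yes _    | no ψ≢    = no λ { refl → ψ≢ refl }
  bin o φ ψ ≟ bin o′ φ′ ψ′ with o ≟ᵇ o′ | φ ≟ φ′ | ψ ≟ ψ′
  ... | yes refl | yes refl | yes refl = yes refl
  ... | no o≢    | _        | _        = no λ { refl → o≢ refl }
  ... | yes _    | no φ≢    | _        = no λ { refl → φ≢ refl }
  ... | yes _    | yes _    | no ψ≢    = no λ { refl → ψ≢ refl }
  const _   ≟ lit _ _   = no λ ()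
  const _   ≟ un _ _    = no λ ()
  const _   ≟ bin _ _ _ = no λ ()
  lit _ _   ≟ const _   = no λ ()
  lit _ _   ≟ un _ _    = no λ ()
  lit _ _   ≟ bin _ _ _ = no λ ()
  un _ _    ≟ const _   = no λ ()
  un _ _    ≟ lit _ _   = no λ ()
  un _ _    ≟ bin _ _ _ = no λ ()
  bin _ _ _ ≟ const _   = no λ ()
  bin _ _ _ ≟ lit _ _   = no λ ()
  bin _ _ _ ≟ un _ _    = no λ ()

  leaves : Property A → List (Property A)
  leaves (const _) = []
  leaves (lit _ a) = atomᵖ a ∷ []
  leaves (un o ψ)  = un o ψ ∷ []
  leaves (φ ∧ᵖ ψ)  = leaves φ ++ leaves ψ
  leaves (φ ∨ᵖ ψ)  = leaves φ ++ leaves ψ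
  leaves (φ 𝖴 ψ)   = φ 𝖴 ψ ∷ []
  leaves (φ 𝖱 ψ)   = φ 𝖱 ψ ∷ []

  evalᵖ-cong : ∀ {v w} ψ → (∀ {ℓ} → ℓ ∈ leaves ψ → v ℓ ≡ w ℓ) → evalᵖ v ψ ≡ evalᵖ w ψ
  evalᵖ-cong (const _) eq = refl
  evalᵖ-cong (atomᵖ _) eq = eq (here refl)
  evalᵖ-cong (¬ᵖ _)    eq = cong not (eq (here refl))
  evalᵖ-cong (un _ _)  eq = eq (here refl)
  evalᵖ-cong (φ ∧ᵖ ψ)  eq =
    cong₂ _∧ᵇ_ (evalᵖ-cong φ (eq ∘ ∈-++⁺ˡ)) (evalᵖ-cong ψ (eq ∘ ∈-++⁺ʳ (leaves φ)))
  evalᵖ-cong (φ ∨ᵖ ψ)  eq =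
    cong₂ _∨ᵇ_ (evalᵖ-cong φ (eq ∘ ∈-++⁺ˡ)) (evalᵖ-cong ψ (eq ∘ ∈-++⁺ʳ (leaves φ)))
  evalᵖ-cong (_ 𝖴 _)   eq = eq (here refl)
  evalᵖ-cong (_ 𝖱 _)   eq = eq (here refl)

  update : (Property A → Bool) → Property A → Bool → Property A → Bool
  update v ℓ b ℓ′ = if does (ℓ′ ≟ ℓ) then b else v ℓ′

  update-≢ : ∀ v ℓ b ℓ′ → ℓ′ ≢ ℓ → update v ℓ b ℓ′ ≡ v ℓ′
  update-≢ v ℓ b ℓ′ ≢ with ℓ′ ≟ ℓ
  ... | yes e = contradiction e ≢
  ... | no _  = refl

  update-self : ∀ (v w : Property A → Bool) ℓ ℓ′ → (ℓ′ ≢ ℓ → w ℓ′ ≡ v ℓ′) → w ℓ′ ≡ update v ℓ (w ℓ) ℓ′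
  update-self v w ℓ ℓ′ eq with ℓ′ ≟ ℓ
  ... | yes refl = refl
  ... | no ≢     = eq ≢

  AgreeOff : Property A → List (Property A) → (v w : Property A → Bool) → Set
  AgreeOff ψ ℓs v w = ∀ ℓ → ℓ ∈ leaves ψ → ℓ ∉ ℓs → w ℓ ≡ v ℓ

  scan : ∀ ψ ℓs v → Dec (∀ w → AgreeOff ψ ℓs v w → evalᵖ w ψ ≡ true)
  scan ψ [] v = map′
    (λ e w ag → trans (evalᵖ-cong ψ (λ {ℓ} ∈ψ → ag ℓ ∈ψ λ ())) e)
    (λ f → f v (λ _ _ _ → refl))
    (evalᵖ v ψ Bool.≟ true)
  scan ψ (ℓ ∷ ℓs) v with scan ψ ℓs (update v ℓ true) | scan ψ ℓs (update v ℓ false)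
  ... | no ¬f | _ = no λ k → ¬f λ w ag → k w
    λ ℓ′ ∈ψ p → trans (ag ℓ′ ∈ψ (p ∘ there)) (update-≢ v ℓ true ℓ′ (p ∘ here))
  ... | yes _ | no ¬g = no λ k → ¬g λ w ag → k w
    λ ℓ′ ∈ψ p → trans (ag ℓ′ ∈ψ (p ∘ there)) (update-≢ v ℓ false ℓ′ (p ∘ here))
  ... | yes f | yes g = yes h
    where
    step : ∀ w → AgreeOff ψ (ℓ ∷ ℓs) v w → AgreeOff ψ ℓs (update v ℓ (w ℓ)) w
    step w ag ℓ′ ∈ψ p =
      update-self v w ℓ ℓ′ λ ≢ → ag ℓ′ ∈ψ λ { (here e) → ≢ e ; (there q) → p q }
    h : ∀ w → AgreeOff ψ (ℓ ∷ ℓs) v w → evalᵖ w ψ ≡ true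
    h w ag with w ℓ | step w ag
    ... | true  | ag′ = f w ag′
    ... | false | ag′ = g w ag′

  _≈⊤? : ∀ ψ → Dec (ψ ≈ ⊤ᵖ)
  ψ ≈⊤? = map′
    (λ f v → f v λ _ ∈ψ ∉ψ → contradiction ∈ψ ∉ψ)
    (λ e w _ → e w)
    (scan ψ (leaves ψ) (λ _ → false))

_≟ᶜ_ : DecidableEquality Cmp
EQ ≟ᶜ EQ = yes refl
EQ ≟ᶜ NE = no λ ()
EQ ≟ᶜ LT = no λ ()
EQ ≟ᶜ GT = no λ ()
NE ≟ᶜ EQ = no λ ()
NE ≟ᶜ NE = yes refl
NE ≟ᶜ LT = no λ ()
NE ≟ᶜ GT = no λ ()
LT ≟ᶜ EQ = no λ ()
LT ≟ᶜ NE = no λ ()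
LT ≟ᶜ LT = yes refl
LT ≟ᶜ GT = no λ ()
GT ≟ᶜ EQ = no λ ()
GT ≟ᶜ NE = no λ ()
GT ≟ᶜ LT = no λ ()
GT ≟ᶜ GT = yes refl

≟-IPC : ∀ {Γ} → DecidableEquality Γ → DecidableEquality (IPC Γ)
≟-IPC _≟_ (eqVar x y) (eqVar x′ y′) with x ≟ x′ | y ≟ y′
... | yes refl | yes refl = yes refl
... | no ≢     | _        = no λ { refl → ≢ refl }
... | yes _    | no ≢     = no λ { refl → ≢ refl }
≟-IPC _≟_ (cmp x c d) (cmp x′ c′ d′) with x ≟ x′ | c ≟ᶜ c′ | d ℕ.≟ d′
... | yes refl | yes refl | yes refl = yes refl
... | no ≢     | _        | _        = no λ { refl → ≢ refl }
... | yes _    | no ≢     | _        = no λ { refl → ≢ refl }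
... | yes _    | yes _    | no ≢     = no λ { refl → ≢ refl }
≟-IPC _≟_ (congVar x k y d) (congVar x′ k′ y′ d′)
  with x ≟ x′ | k ℕ.≟ k′ | y ≟ y′ | d ℕ.≟ d′
... | yes refl | yes refl | yes refl | yes refl = yes refl
... | no ≢     | _        | _        | _        = no λ { refl → ≢ refl }
... | yes _    | no ≢     | _        | _        = no λ { refl → ≢ refl }
... | yes _    | yes _    | no ≢     | _        = no λ { refl → ≢ refl }
... | yes _    | yes _    | yes _    | no ≢     = no λ { refl → ≢ refl }
≟-IPC _≟_ (congNum x k d) (congNum x′ k′ d′) with x ≟ x′ | k ℕ.≟ k′ | d ℕ.≟ d′
... | yes refl | yes refl | yes refl = yes refl
... | no ≢     | _        | _        = no λ { refl → ≢ refl }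
... | yes _    | no ≢     | _        = no λ { refl → ≢ refl }
... | yes _    | yes _    | no ≢     = no λ { refl → ≢ refl }
≟-IPC _ (eqVar _ _)       (cmp _ _ _)       = no λ ()
≟-IPC _ (eqVar _ _)       (congVar _ _ _ _) = no λ ()
≟-IPC _ (eqVar _ _)       (congNum _ _ _)   = no λ ()
≟-IPC _ (cmp _ _ _)       (eqVar _ _)       = no λ ()
≟-IPC _ (cmp _ _ _)       (congVar _ _ _ _) = no λ ()
≟-IPC _ (cmp _ _ _)       (congNum _ _ _)   = no λ ()
≟-IPC _ (congVar _ _ _ _) (eqVar _ _)       = no λ ()
≟-IPC _ (congVar _ _ _ _) (cmp _ _ _)       = no λ ()
≟-IPC _ (congVar _ _ _ _) (congNum _ _ _)   = no λ ()
≟-IPC _ (congNum _ _ _)   (eqVar _ _)       = no λ ()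
≟-IPC _ (congNum _ _ _)   (cmp _ _ _)       = no λ ()
≟-IPC _ (congNum _ _ _)   (congVar _ _ _ _) = no λ ()

_≈⊤? : ∀ {m n} (χ : Label m n) → Dec (χ ≈ ⊤ᵖ)
_≈⊤? = Decide._≈⊤? (Maybe.≡-dec (≟-IPC (Sum.≡-dec ≟-V ≟-V)))
  where
  ≟-V : ∀ {m n} → DecidableEquality (V m n)
  ≟-V = Sum.≡-dec Fin._≟_ Fin._≟_

FreeOf : ∀ {m n} → List (IPC (Var m n)) → Label m n → Set
FreeOf C (lit _ (just a)) = a ∉ C
FreeOf C _                = ⊤

Part : ℕ → ℕ → Set
Part m n = FO (IPC (Var m n)) × Label m n

prmᴸ : ∀ {m n} → Part m n → Label m n
prmᴸ (prm , _) = embed ⌈ prm ⌉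

record IsDecomposition {m n} (χ : Label m n) (C : List (IPC (Var m n)))
                       (parts : List (Part m n)) : Set where
  field
    equivalent   : χ ≈ ⋁ᵖ (map (λ p → prmᴸ p ∧ᵖ proj₂ p) parts)
    prm-over-C   : All (λ p → All (_∈ C) (atomsᶠ (proj₁ p))) parts
    sub-free-C   : All (λ p → All (FreeOf C) (tnps (proj₂ p))) parts
    prm-disjoint : AllPairs (λ p q → prmᴸ p ∧ᵖ prmᴸ q ≈ ⊥ᵖ) parts
    prm-covering : ⋁ᵖ (map prmᴸ parts) ≈ ⊤ᵖ
    sub-distinct : AllPairs (λ p q → proj₂ p ≢ proj₂ q) parts

record Decomposition (m n : ℕ) : Set where
  field
    decomp          : Label m n → List (IPC (Var m n)) → List (Part m n)
    isDecomposition : ∀ χ C → XNF χ → IsDecomposition χ C (decomp χ C)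

-- The free variables are in Γ; a quantifier binds a block of k variables.
data Form : Set → Set₁ where
  qf          : ∀ {Γ} → FO (IPC Γ) → Form Γ
  _∧_ _∨_ _⇒_ : ∀ {Γ} → Form Γ → Form Γ → Form Γ
  ∀ᵇ ∃ᵇ       : ∀ {Γ} k → Form (Γ ⊎ Fin k) → Form Γ

infixr 4 _⇒_

extend : ∀ {Γ : Set} {k} → (Γ → ℤ) → Vec ℤ k → Γ ⊎ Fin k → ℤ
extend ρ xs (inj₁ z) = ρ z
extend ρ xs (inj₂ i) = lookup xs i

⟦_⟧ : ∀ {Γ} → Form Γ → (Γ → ℤ) → Set
⟦ qf φ   ⟧ ρ = ⟦ φ ⟧ᶠ (λ a → ⟦ a ⟧ᵃ ρ)
⟦ φ ∧ χ  ⟧ ρ = ⟦ φ ⟧ ρ × ⟦ χ ⟧ ρ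
⟦ φ ∨ χ  ⟧ ρ = ⟦ φ ⟧ ρ ⊎ ⟦ χ ⟧ ρ
⟦ φ ⇒ χ  ⟧ ρ = ⟦ φ ⟧ ρ → ⟦ χ ⟧ ρ
⟦ ∀ᵇ k φ ⟧ ρ = ∀ xs → ⟦ φ ⟧ (extend ρ xs)
⟦ ∃ᵇ k φ ⟧ ρ = ∃[ xs ] ⟦ φ ⟧ (extend ρ xs)

infix 4 _≋_
_≋_ : ∀ {Γ} → Form Γ → Form Γ → Set
φ ≋ χ = ∀ ρ → ⟦ φ ⟧ ρ ⇔ ⟦ χ ⟧ ρ

Satisfiable : ∀ {Γ} → Form Γ → Set
Satisfiable φ = ∃[ ρ ] ⟦ φ ⟧ ρ

lift : ∀ {Γ Δ : Set} {k} → (Γ → Δ) → Γ ⊎ Fin k → Δ ⊎ Fin k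
lift f (inj₁ z) = inj₁ (f z)
lift f (inj₂ i) = inj₂ i

rename : ∀ {Γ Δ} → (Γ → Δ) → Form Γ → Form Δ
rename f (qf φ)   = qf (mapᶠ (mapᵃ f) φ)
rename f (φ ∧ χ)  = rename f φ ∧ rename f χ
rename f (φ ∨ χ)  = rename f φ ∨ rename f χ
rename f (φ ⇒ χ)  = rename f φ ⇒ rename f χ
rename f (∀ᵇ k φ) = ∀ᵇ k (rename (lift f) φ)
rename f (∃ᵇ k φ) = ∃ᵇ k (rename (lift f) φ)

⋀ ⋁ : ∀ {Γ} → List (Form Γ) → Form Γ
⋀ = foldr _∧_ (qf (const true))
⋁ = foldr _∨_ (qf (const false))

bindX : ∀ {m n} → Var m n → Var m n ⊎ Fin m
bindX (now (inj₁ x)) = inj₂ x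
bindX z              = inj₁ z

bindY : ∀ {m n} → Var m n → Var m n ⊎ Fin n
bindY (now (inj₂ y)) = inj₂ y
bindY z              = inj₁ z

∀X ∃Y : ∀ {m n} → Form (Var m n) → Form (Var m n)
∀X {m}     φ = ∀ᵇ m (rename bindX φ)
∃Y {n = n} φ = ∃ᵇ n (rename bindY φ)

-- Only used where the current variables no longer occur free.
unprime : ∀ {m n} → Var m n → V m n
unprime (now v)    = v
unprime (before v) = v

-- Nodes are identified with their labels, so equal labels are shared.
module AO {m n} (D : Decomposition m n) (ψ : IPCProperty m n) where

  open Decomposition D

  C-env C-ag : List (IPC (Var m n))
  C-env = filter (λ a → ¬? (any? isAgent? (vars a))) (atomsᵖ ψ)
  C-ag  = filter (λ a → any? isAgent? (vars a)) (atomsᵖ ψ)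

  s₀ : Label m n
  s₀ = embed ψ

  andEdges orEdges : Label m n → List (Part m n)
  andEdges s = if does (s ≈⊤?) then [] else decomp (xnf s) C-env
  orEdges t  = map (λ (prm , sub) → prm , xnf (rmX sub)) (decomp (xnf t) C-ag)

  -- In a label, last means that the trace has ended just before.  A play may
  -- thus stop at labels that become ⊤ once last is true: G φ is realized by
  -- a single instant satisfying φ, yet the label reached is G φ ∨ last.
  Final : Label m n → Set
  Final s = ¬ᵖ last ∨ᵖ s ≈ ⊤ᵖ

  final? : ∀ s → Dec (Final s)
  final? s = (¬ᵖ last ∨ᵖ s) ≈⊤?

  Pre′ : (Label m n → Form (V m n)) → Label m n → Form (Var m n)
  Pre′ 𝓒 t = ⋁ (map (λ (ς , u) → ∃Y (qf ς ∧ rename now (𝓒 u))) (orEdges t))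

  Pre : (Label m n → Form (V m n)) → Label m n → Form (V m n)
  Pre 𝓒 s = ⋀ (map (λ (w , t) → rename unprime (∀X (qf w ⇒ Pre′ 𝓒 t))) (andEdges s))

  Win : ℕ → Label m n → Form (V m n)
  Win zero    s = if does (final? s) then qf (const true) else qf (const false)
  Win (suc i) s = Win i s ∨ Pre (Win i) s

  -- The infinite disjunction ⋁ᵢ Winᵢ(s₀).
  Win-AO : (V m n → ℤ) → Set
  Win-AO ρ = ∃[ i ] ⟦ Win i s₀ ⟧ ρ

  -- The strategies g obtainable from K: node maps π|ₖ to sₖ.  The edge guard
  -- w has no Y-variables, so its value does not depend on g (π|ₖ₊₁).
  record Strategy (K : ℕ) : Set where
    field
      g     : List (Vec ℤ m) → Vec ℤ n
      node  : List (Vec ℤ m) → Label m n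
      start : node [] ≡ s₀
      step  : ∀ π k → (∀ j → j ℕ.≤ k → ¬ Final (node (prefix π j))) →
              let α = play g π; η = holds (previous α k) (α k) in
              Σ[ (w , t) ∈ Part m n ] Σ[ (ς , u) ∈ Part m n ]
                (w , t) ∈ andEdges (node (prefix π k)) ×
                ⟦ w ⟧ᶠ η ×
                (ς , u) ∈ orEdges t ×
                ⟦ ς ⟧ᶠ η × ⟦ Win (K ∸ k) u ⟧ (value (α k)) ×
                node (prefix π (suc k)) ≡ u

{-# OPTIONS --safe #-}

-- A label matters only through the Boolean function that it defines on
-- valuations of its leaves, and reading an instant acts on such functions by
-- precomposition with a map back determined by the truth values of the atoms.
-- So Winᵢ(s) describes a game on Boolean functions over finitely many leaves
-- and previous assignments.  An Ehrenfeucht–Fraïssé argument (assignments are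
-- similar if they have the same equalities, the same order with respect to the
-- constants and the same residues) shows that the game only sees finitely many
-- assignments; hence it is decidable and Winᵢ stabilizes at some K.  If Win_K
-- holds at s₀, then each round lowers the index until a final label is reached,
-- which means that the trace so far satisfies ψ.  If it does not, then
-- stability lets the environment escape forever, against every strategy.
module Submission where

open import Defs
open import Data.Bool.Base using (Bool; true; false; not; if_then_else_)
  renaming (_∧_ to _∧ᵇ_; _∨_ to _∨ᵇ_)
import Data.Bool.Properties as Bool
open import Data.Empty using (⊥; ⊥-elim)
open import Data.Fin.Base using (Fin; zero; suc)
import Data.Fin.Properties as Fin
open import Data.Integer.Base as ℤ using (ℤ; +_; -[1+_])
import Data.Integer.Properties as ℤ
import Data.Integer.Divisibility as Unsigned
open import Data.Integer.Divisibility.Signed as Signed using (divides; ∣ᵤ⇒∣; ∣⇒∣ᵤ)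
import Data.Integer.Solver as ℤ-Solver
open import Data.List.Base using
  (List; []; _∷_; _++_; map; filter; length; upTo; allFin; concatMap;
   cartesianProduct; cartesianProductWith)
import Data.List.Properties as List
open import Data.List.Membership.Propositional using (_∈_; _∉_; find; lose)
open import Data.List.Membership.Propositional.Properties
open import Data.List.Relation.Unary.All as All using (All; []; _∷_; all?)
import Data.List.Relation.Unary.All.Properties as All
open import Data.List.Relation.Unary.AllPairs using (AllPairs; []; _∷_)
open import Data.List.Relation.Unary.Any as Any using (Any; any?; here; there)
open import Data.Maybe.Base using (Maybe; just; nothing)
import Data.Maybe.Properties as Maybe
open import Data.Nat.Base as ℕ using (ℕ; zero; suc; _+_; _∸_; NonZero; z≤n; s≤s)
import Data.Nat.Divisibility as ℕ
open import Data.Nat.ListAction using (sum)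
open import Data.Nat.DivMod using (_%_; _/_; m%n<n; m≡m%n+[m/n]*n)
import Data.Nat.Properties as ℕ
open import Data.Product.Base using (Σ; Σ-syntax; ∃; ∃-syntax; _×_; _,_; proj₁; proj₂)
open import Data.Sum.Base using (_⊎_; inj₁; inj₂; [_,_]′)
import Data.Sum.Properties as Sum
open import Data.Unit.Base using (⊤; tt)
open import Data.Vec.Base as Vec using (Vec; []; _∷_; lookup; tabulate; replicate)
import Data.Vec.Properties as Vec
open import Data.Product.Function.NonDependent.Propositional using (_×-⇔_)
open import Data.Sum.Function.Propositional using (_⊎-⇔_)
open import Function.Related.TypeIsomorphisms using (→-cong-⇔; ¬-cong-⇔)
open import Function.Base using (_∘_; id)
open import Function.Bundles using (_⇔_; mk⇔; Equivalence)
open import Function.Construct.Identity using (⇔-id)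
open import Function.Construct.Symmetry using (⇔-sym)
open import Function.Construct.Composition using (_⇔-∘_)
open import Relation.Binary.Definitions using (DecidableEquality)
open import Relation.Binary.PropositionalEquality
open import Relation.Nullary using (¬_; Dec; yes; no; does; contradiction; Reflects; ofʸ; ofⁿ)
open import Relation.Nullary.Decidable using
  (¬?; map′; decidable-stable; does-⇔; proof; _⊎-dec_; _×-dec_; _→-dec_)
open import Relation.Nullary.Reflects using (¬-reflects; _×-reflects_; _⊎-reflects_)

-- Propositional evaluation and decompositions

Val : ℕ → ℕ → Set
Val m n = Label m n → Bool

module _ {m n : ℕ} where

  _≟ⱽ_ : DecidableEquality (V m n)
  _≟ⱽ_ = Sum.≡-dec Fin._≟_ Fin._≟_

  _≟ᴬ_ : DecidableEquality (IPC (Var m n))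
  _≟ᴬ_ = ≟-IPC (Sum.≡-dec _≟ⱽ_ _≟ⱽ_)

  open Decide (Maybe.≡-dec _≟ᴬ_) public using (leaves; evalᵖ-cong; update; update-self)

  _∈?_ : (a : IPC (Var m n)) (C : List (IPC (Var m n))) → Dec (a ∈ C)
  a ∈? C = any? (a ≟ᴬ_) C

  evalᵖ-xnf : ∀ (v : Val m n) s → evalᵖ v (xnf s) ≡ evalᵖ (λ ℓ → evalᵖ v (xnf ℓ)) s
  evalᵖ-xnf v (const _) = refl
  evalᵖ-xnf v (atomᵖ _) = refl
  evalᵖ-xnf v (¬ᵖ _)    = refl
  evalᵖ-xnf v (un _ _)  = refl
  evalᵖ-xnf v (φ ∧ᵖ χ)  = cong₂ _∧ᵇ_ (evalᵖ-xnf v φ) (evalᵖ-xnf v χ)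
  evalᵖ-xnf v (φ ∨ᵖ χ)  = cong₂ _∨ᵇ_ (evalᵖ-xnf v φ) (evalᵖ-xnf v χ)
  evalᵖ-xnf v (_ 𝖴 _)   = refl
  evalᵖ-xnf v (_ 𝖱 _)   = refl

  evalᵖ-xnf-rmX : ∀ (v : Val m n) s →
    evalᵖ v (xnf (rmX s)) ≡ evalᵖ (λ ℓ → evalᵖ v (xnf (rmX ℓ))) s
  evalᵖ-xnf-rmX v (const _)        = refl
  evalᵖ-xnf-rmX v (atomᵖ last)     = refl
  evalᵖ-xnf-rmX v (atomᵖ (just _)) = refl
  evalᵖ-xnf-rmX v (¬ᵖ last)        = refl
  evalᵖ-xnf-rmX v (¬ᵖ (just _))    = refl
  evalᵖ-xnf-rmX v (𝖷 _)            = refl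
  evalᵖ-xnf-rmX v (𝖷ʷ _)           = refl
  evalᵖ-xnf-rmX v (φ ∧ᵖ χ)         = cong₂ _∧ᵇ_ (evalᵖ-xnf-rmX v φ) (evalᵖ-xnf-rmX v χ)
  evalᵖ-xnf-rmX v (φ ∨ᵖ χ)         = cong₂ _∨ᵇ_ (evalᵖ-xnf-rmX v φ) (evalᵖ-xnf-rmX v χ)
  evalᵖ-xnf-rmX v (_ 𝖴 _)          = refl
  evalᵖ-xnf-rmX v (_ 𝖱 _)          = refl

  xnf-XNF : ∀ (s : Label m n) → XNF (xnf s)
  xnf-XNF (const _) = tt
  xnf-XNF (lit _ _) = tt
  xnf-XNF (un _ _)  = tt
  xnf-XNF (φ ∧ᵖ χ)  = xnf-XNF φ , xnf-XNF χ
  xnf-XNF (φ ∨ᵖ χ)  = xnf-XNF φ , xnf-XNF χ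
  xnf-XNF (φ 𝖴 χ)   = xnf-XNF χ , xnf-XNF φ , tt
  xnf-XNF (φ 𝖱 χ)   = (xnf-XNF χ , tt) , xnf-XNF φ , tt

  override : List (IPC (Var m n)) → (IPC (Var m n) → Bool) → Val m n → Val m n
  override C I v (atomᵖ (just a)) = if does (a ∈? C) then I a else v (atomᵖ (just a))
  override C I v ℓ                = v ℓ

  override-∈ : ∀ {C} I v {a} → a ∈ C → override C I v (atomᵖ (just a)) ≡ I a
  override-∈ {C} I v {a} a∈ with a ∈? C
  ... | yes _ = refl
  ... | no a∉ = contradiction a∈ a∉

  override-∉ : ∀ {C} I v {a} → a ∉ C → override C I v (atomᵖ (just a)) ≡ v (atomᵖ (just a))
  override-∉ {C} I v {a} a∉ with a ∈? C
  ... | yes a∈ = contradiction a∈ a∉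
  ... | no _  = refl

  evalᵖ-override : ∀ C I (v : Val m n) χ → All (FreeOf C) (tnps χ) →
    evalᵖ (override C I v) χ ≡ evalᵖ v χ
  evalᵖ-override C I v (const _) _ = refl
  evalᵖ-override C I v (atomᵖ last) _ = refl
  evalᵖ-override C I v (¬ᵖ last) _ = refl
  evalᵖ-override C I v (atomᵖ (just a)) (a∉ ∷ []) = override-∉ I v a∉
  evalᵖ-override C I v (¬ᵖ (just a)) (a∉ ∷ []) = cong not (override-∉ I v a∉)
  evalᵖ-override C I v (un _ _) _ = refl
  evalᵖ-override C I v (φ ∧ᵖ χ) f = cong₂ _∧ᵇ_
    (evalᵖ-override C I v φ (All.++⁻ˡ (tnps φ) f)) (evalᵖ-override C I v χ (All.++⁻ʳ (tnps φ) f))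
  evalᵖ-override C I v (φ ∨ᵖ χ) f = cong₂ _∨ᵇ_
    (evalᵖ-override C I v φ (All.++⁻ˡ (tnps φ) f)) (evalᵖ-override C I v χ (All.++⁻ʳ (tnps φ) f))
  evalᵖ-override C I v (_ 𝖴 _) _ = refl
  evalᵖ-override C I v (_ 𝖱 _) _ = refl

  evalᶠ : (IPC (Var m n) → Bool) → FO (IPC (Var m n)) → Bool
  evalᶠ I (const b)     = b
  evalᶠ I (lit true a)  = I a
  evalᶠ I (lit false a) = not (I a)
  evalᶠ I (φ ∧ χ)       = evalᶠ I φ ∧ᵇ evalᶠ I χ
  evalᶠ I (φ ∨ χ)       = evalᶠ I φ ∨ᵇ evalᶠ I χ

  evalᶠ-reflects : ∀ {P : IPC (Var m n) → Set} {I} → (∀ a → Reflects (P a) (I a)) →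
    ∀ φ → Reflects (⟦ φ ⟧ᶠ P) (evalᶠ I φ)
  evalᶠ-reflects r (const true)  = ofʸ tt
  evalᶠ-reflects r (const false) = ofⁿ id
  evalᶠ-reflects r (lit true a)  = r a
  evalᶠ-reflects r (lit false a) = ¬-reflects (r a)
  evalᶠ-reflects r (φ ∧ χ)       = evalᶠ-reflects r φ ×-reflects evalᶠ-reflects r χ
  evalᶠ-reflects r (φ ∨ χ)       = evalᶠ-reflects r φ ⊎-reflects evalᶠ-reflects r χ

  evalᶠ-cong : ∀ {I I′} φ → All (λ a → I a ≡ I′ a) (atomsᶠ φ) → evalᶠ I φ ≡ evalᶠ I′ φ
  evalᶠ-cong (const _)     _         = refl
  evalᶠ-cong (lit true _)  (eq ∷ []) = eq
  evalᶠ-cong (lit false _) (eq ∷ []) = cong not eq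
  evalᶠ-cong (φ ∧ χ)       eq        = cong₂ _∧ᵇ_
    (evalᶠ-cong φ (All.++⁻ˡ (atomsᶠ φ) eq)) (evalᶠ-cong χ (All.++⁻ʳ (atomsᶠ φ) eq))
  evalᶠ-cong (φ ∨ χ)       eq        = cong₂ _∨ᵇ_
    (evalᶠ-cong φ (All.++⁻ˡ (atomsᶠ φ) eq)) (evalᶠ-cong χ (All.++⁻ʳ (atomsᶠ φ) eq))

  evalᵖ-⌈⌉ : ∀ (v : Val m n) φ → evalᵖ v (embed ⌈ φ ⌉) ≡ evalᶠ (λ a → v (atomᵖ (just a))) φ
  evalᵖ-⌈⌉ v (const _)     = refl
  evalᵖ-⌈⌉ v (lit true _)  = refl
  evalᵖ-⌈⌉ v (lit false _) = refl
  evalᵖ-⌈⌉ v (φ ∧ χ)       = cong₂ _∧ᵇ_ (evalᵖ-⌈⌉ v φ) (evalᵖ-⌈⌉ v χ)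
  evalᵖ-⌈⌉ v (φ ∨ χ)       = cong₂ _∨ᵇ_ (evalᵖ-⌈⌉ v φ) (evalᵖ-⌈⌉ v χ)

  ⋁ᵖ-false : ∀ (v : Val m n) {A : Set} {f : A → Label m n} {xs} →
    All (λ x → evalᵖ v (f x) ≡ false) xs → evalᵖ v (⋁ᵖ (map f xs)) ≡ false
  ⋁ᵖ-false v []           = refl
  ⋁ᵖ-false v (eq ∷ rest) rewrite eq = ⋁ᵖ-false v rest

  ⋁ᵖ-true : ∀ (v : Val m n) {A : Set} {f : A → Label m n} xs →
    evalᵖ v (⋁ᵖ (map f xs)) ≡ true → Any (λ x → evalᵖ v (f x) ≡ true) xs
  ⋁ᵖ-true v {f = f} (x ∷ xs) eq with evalᵖ v (f x) in e
  ... | true  = here e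
  ... | false = there (⋁ᵖ-true v xs eq)

  guarded-false : ∀ (v : Val m n) p q → evalᵖ v (prmᴸ p) ≡ true → (prmᴸ p ∧ᵖ prmᴸ q ≈ ⊥ᵖ) →
    evalᵖ v (prmᴸ q ∧ᵖ proj₂ q) ≡ false
  guarded-false v p q eq disj with evalᵖ v (prmᴸ p) | evalᵖ v (prmᴸ q) | disj v
  ... | true | false | _ = refl
  guarded-false v p q () disj | false | _ | _

  ∧-comm-≈⊥ : ∀ (φ χ : Label m n) → φ ∧ᵖ χ ≈ ⊥ᵖ → χ ∧ᵖ φ ≈ ⊥ᵖ
  ∧-comm-≈⊥ φ χ eq v = trans (Bool.∧-comm (evalᵖ v χ) (evalᵖ v φ)) (eq v)

  ⋁ᵖ-unique : ∀ (v : Val m n) {p parts} → p ∈ parts → evalᵖ v (prmᴸ p) ≡ true →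
    AllPairs (λ p q → prmᴸ p ∧ᵖ prmᴸ q ≈ ⊥ᵖ) parts →
    evalᵖ v (⋁ᵖ (map (λ p → prmᴸ p ∧ᵖ proj₂ p) parts)) ≡ evalᵖ v (proj₂ p)
  ⋁ᵖ-unique v {p} (here refl) eq (disj ∷ _)
    rewrite eq
          | ⋁ᵖ-false v {f = λ p → prmᴸ p ∧ᵖ proj₂ p}
              (All.map (λ {q} → guarded-false v p q eq) disj) =
    Bool.∨-identityʳ _
  ⋁ᵖ-unique v {p} {q ∷ _} (there p∈) eq (disj ∷ rest)
    rewrite guarded-false v p q eq (∧-comm-≈⊥ (prmᴸ q) (prmᴸ p) (All.lookup disj p∈)) =
    ⋁ᵖ-unique v p∈ eq rest

  module _ {χ : Label m n} {C : List (IPC (Var m n))} {parts : List (Part m n)}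
           (dec : IsDecomposition χ C parts) where
    open IsDecomposition dec

    some-guard : ∀ I → ∃[ p ] p ∈ parts × evalᶠ I (proj₁ p) ≡ true
    some-guard I with find (⋁ᵖ-true (override C I (λ _ → false)) parts (prm-covering _))
    ... | p , p∈ , eq = p , p∈ , trans (sym (trans (evalᵖ-⌈⌉ _ (proj₁ p))
      (evalᶠ-cong (proj₁ p) (All.map (override-∈ I (λ _ → false)) (All.lookup prm-over-C p∈))))) eq

    evalᵖ-decomp : ∀ I v {p} → p ∈ parts → evalᶠ I (proj₁ p) ≡ true →
      evalᵖ (override C I v) χ ≡ evalᵖ v (proj₂ p)
    evalᵖ-decomp I v {p} p∈ eq =
      trans (equivalent _)
        (trans (⋁ᵖ-unique (override C I v) p∈
                 (trans (evalᵖ-⌈⌉ _ (proj₁ p))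
                   (trans (evalᶠ-cong (proj₁ p)
                            (All.map (override-∈ I v) (All.lookup prm-over-C p∈))) eq))
                 prm-disjoint)
          (evalᵖ-override C I v (proj₂ p) (All.lookup sub-free-C p∈)))

-- Integer periodicity constraints

⟦_⟧ᶜ? : ∀ c i j → Dec (⟦ c ⟧ᶜ i j)
⟦ EQ ⟧ᶜ? i j = i ℤ.≟ j
⟦ NE ⟧ᶜ? i j = ¬? (i ℤ.≟ j)
⟦ LT ⟧ᶜ? i j = i ℤ.<? j
⟦ GT ⟧ᶜ? i j = j ℤ.<? i

⟦_⟧ᵃ? : ∀ {Γ} a (ρ : Γ → ℤ) → Dec (⟦ a ⟧ᵃ ρ)
⟦ eqVar x y ⟧ᵃ?       ρ = ρ x ℤ.≟ ρ y
⟦ cmp x c d ⟧ᵃ?       ρ = ⟦ c ⟧ᶜ? (ρ x) (+ d)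
⟦ congVar x k y d ⟧ᵃ? ρ = k ℕ.∣? _
⟦ congNum x k d ⟧ᵃ?   ρ = k ℕ.∣? _

⟦⟧ᵃ-cong : ∀ {Γ} (a : IPC Γ) {ρ ρ′ : Γ → ℤ} → All (λ x → ρ x ≡ ρ′ x) (vars a) →
  ⟦ a ⟧ᵃ ρ → ⟦ a ⟧ᵃ ρ′
⟦⟧ᵃ-cong (eqVar x y)       (ex ∷ ey ∷ []) = subst₂ _≡_ ex ey
⟦⟧ᵃ-cong (cmp x c d)       (ex ∷ [])      = subst (λ i → ⟦ c ⟧ᶜ i (+ d)) ex
⟦⟧ᵃ-cong (congVar x k y d) (ex ∷ ey ∷ []) =
  subst₂ (λ i j → + k Unsigned.∣ (i ℤ.- (j ℤ.+ + d))) ex ey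
⟦⟧ᵃ-cong (congNum x k d)   (ex ∷ [])      = subst (λ i → + k Unsigned.∣ (i ℤ.- + d)) ex

⟦⟧ᵃ-map : ∀ {Γ Δ} (f : Γ → Δ) (a : IPC Γ) (ρ : Δ → ℤ) → ⟦ mapᵃ f a ⟧ᵃ ρ ⇔ ⟦ a ⟧ᵃ (ρ ∘ f)
⟦⟧ᵃ-map f (eqVar _ _)       ρ = ⇔-id _
⟦⟧ᵃ-map f (cmp _ _ _)       ρ = ⇔-id _
⟦⟧ᵃ-map f (congVar _ _ _ _) ρ = ⇔-id _
⟦⟧ᵃ-map f (congNum _ _ _)   ρ = ⇔-id _

Fits : ∀ {Γ} → ℕ → ℕ → IPC Γ → Set
Fits B M (eqVar _ _)       = ⊤
Fits B M (cmp _ _ d)       = d ℕ.≤ B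
Fits B M (congVar _ k _ _) = k ℕ.∣ M
Fits B M (congNum _ k _)   = k ℕ.∣ M

fits-mono : ∀ {Γ B B′ M M′} (a : IPC Γ) → B ℕ.≤ B′ → M ℕ.∣ M′ → Fits B M a → Fits B′ M′ a
fits-mono (eqVar _ _)       _  _  _ = tt
fits-mono (cmp _ _ _)       B≤ _  f = ℕ.≤-trans f B≤
fits-mono (congVar _ _ _ _) _  M∣ f = ℕ.∣-trans f M∣
fits-mono (congNum _ _ _)   _  M∣ f = ℕ.∣-trans f M∣

fit : ∀ {Γ} (a : IPC Γ) → ∃[ B ] ∃[ M ] NonZero M × Fits B M a
fit (eqVar _ _)               = 0 , 1 , _ , tt
fit (cmp _ _ d)               = d , 1 , _ , ℕ.≤-refl
fit (congVar _ (suc k) _ _) = 0 , suc k , _ , ℕ.∣-refl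
fit (congNum _ (suc k) _)   = 0 , suc k , _ , ℕ.∣-refl

fit-all : ∀ {Γ} (as : List (IPC Γ)) → ∃[ B ] ∃[ M ] NonZero M × All (Fits B M) as
fit-all []       = 0 , 1 , _ , []
fit-all (a ∷ as) with fit a | fit-all as
... | B , M , nz , f | B′ , M′ , nz′ , fs =
  B + B′ , M ℕ.* M′ , ℕ.m*n≢0 M M′ {{nz}} {{nz′}} ,
  fits-mono a (ℕ.m≤m+n B B′) (ℕ.m∣m*n M′) f ∷
  All.map (λ {a} → fits-mono a (ℕ.m≤n+m B′ B) (ℕ.n∣m*n M)) fs

module Similarity (B M : ℕ) {{_ : NonZero M}} where

  record Alike (i j : ℤ) : Set where
    constructor alike
    field
      same-cmp  : ∀ c {d} → d ℕ.≤ B → ⟦ c ⟧ᶜ i (+ d) ⇔ ⟦ c ⟧ᶜ j (+ d)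
      same-cong : + M Signed.∣ (i ℤ.- j)

  open Alike

  infix 4 _∼_
  record _∼_ {Γ : Set} (ρ ρ′ : Γ → ℤ) : Set where
    field
      same-eq : ∀ x y → ρ x ≡ ρ y ⇔ ρ′ x ≡ ρ′ y
      alikeᵛ  : ∀ x → Alike (ρ x) (ρ′ x)

  open _∼_

  ∣-swap : ∀ k i j → k Signed.∣ (i ℤ.- j) → k Signed.∣ (j ℤ.- i)
  ∣-swap k i j k∣ = subst (k Signed.∣_)
    (solve 2 (λ i j → :- (i :- j) := j :- i) refl i j) (Signed.∣m⇒∣-m k∣)
    where open ℤ-Solver.+-*-Solver

  alike-refl : ∀ {i} → Alike i i
  alike-refl {i} = alike (λ _ _ → ⇔-id _) (divides (+ 0) (ℤ.+-inverseʳ i))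

  alike-sym : ∀ {i j} → Alike i j → Alike j i
  alike-sym {i} {j} a = alike (λ c d≤ → ⇔-sym (same-cmp a c d≤)) (∣-swap (+ M) i j (same-cong a))

  ∼-refl : ∀ {Γ} {ρ : Γ → ℤ} → ρ ∼ ρ
  ∼-refl = record { same-eq = λ _ _ → ⇔-id _ ; alikeᵛ = λ _ → alike-refl }

  ∼-sym : ∀ {Γ} {ρ ρ′ : Γ → ℤ} → ρ ∼ ρ′ → ρ′ ∼ ρ
  ∼-sym e = record { same-eq = λ x y → ⇔-sym (same-eq e x y) ; alikeᵛ = alike-sym ∘ alikeᵛ e }

  ∼-pullback : ∀ {Γ Δ} {ρ ρ′ : Γ → ℤ} {σ σ′ : Δ → ℤ} (f : Δ → Γ) →
    (∀ x → ρ (f x) ≡ σ x) → (∀ x → ρ′ (f x) ≡ σ′ x) → ρ ∼ ρ′ → σ ∼ σ′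
  ∼-pullback f eq eq′ e = record
    { same-eq = λ x y → subst₂ _⇔_ (cong₂ _≡_ (eq x) (eq y)) (cong₂ _≡_ (eq′ x) (eq′ y))
                          (same-eq e (f x) (f y))
    ; alikeᵛ  = λ x → subst₂ Alike (eq x) (eq′ x) (alikeᵛ e (f x))
    }

  ∣-shift : ∀ {k} → k ℕ.∣ M → ∀ {i i′ j j′} → Alike i i′ → Alike j j′ →
    ∀ d → + k Unsigned.∣ (i ℤ.- (j ℤ.+ d)) → + k Unsigned.∣ (i′ ℤ.- (j′ ℤ.+ d))
  ∣-shift {k} k∣M {i} {i′} {j} {j′} ai aj d k∣ = ∣⇒∣ᵤ (subst (+ k Signed.∣_)
    (solve 5 (λ i i′ j j′ d → ((i :- (j :+ d)) :- (i :- i′)) :+ (j :- j′) := i′ :- (j′ :+ d))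
       refl i i′ j j′ d)
    (Signed.∣m∣n⇒∣m+n
      (Signed.∣m∣n⇒∣m-n (∣ᵤ⇒∣ {+ k} {i ℤ.- (j ℤ.+ d)} k∣) (M∣⇒k∣ (same-cong ai)))
      (M∣⇒k∣ (same-cong aj))))
    where
    open ℤ-Solver.+-*-Solver
    M∣⇒k∣ : ∀ {i} → + M Signed.∣ i → + k Signed.∣ i
    M∣⇒k∣ = Signed.∣-trans (∣ᵤ⇒∣ {+ k} {+ M} k∣M)

  ∼-sound : ∀ {Γ} {ρ ρ′ : Γ → ℤ} → ρ ∼ ρ′ → ∀ a → Fits B M a → ⟦ a ⟧ᵃ ρ → ⟦ a ⟧ᵃ ρ′
  ∼-sound e (eqVar x y) _ = Equivalence.to (same-eq e x y)
  ∼-sound e (cmp x c d) d≤B = Equivalence.to (same-cmp (alikeᵛ e x) c d≤B)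
  ∼-sound e (congVar x k y d) k∣M = ∣-shift k∣M (alikeᵛ e x) (alikeᵛ e y) (+ d)
  ∼-sound {ρ = ρ} {ρ′} e (congNum x k d) k∣M h =
    subst (λ j → + k Unsigned.∣ (ρ′ x ℤ.- j)) (ℤ.+-identityˡ (+ d))
      (∣-shift k∣M (alikeᵛ e x) (alike-refl {+ 0}) (+ d)
        (subst (λ j → + k Unsigned.∣ (ρ x ℤ.- j)) (sym (ℤ.+-identityˡ (+ d))) h))

  ∣-residue : ∀ c e t → + M Signed.∣ (+ (c + e) ℤ.- + (c + (e % M + t ℕ.* M)))
  ∣-residue c e t = subst (λ e′ → + M Signed.∣ (+ (c + e′) ℤ.- + (c + (e % M + t ℕ.* M))))
    (sym (m≡m%n+[m/n]*n e M)) (go (e % M) (e / M))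
    where
    open ℤ-Solver.+-*-Solver
    pos : ∀ r q → + (c + (r + q ℕ.* M)) ≡ + c ℤ.+ (+ r ℤ.+ + q ℤ.* + M)
    pos r q = trans (ℤ.pos-+ c _) (cong (ℤ._+_ (+ c))
      (trans (ℤ.pos-+ r _) (cong (ℤ._+_ (+ r)) (ℤ.pos-* q M))))
    go : ∀ r q → + M Signed.∣ (+ (c + (r + q ℕ.* M)) ℤ.- + (c + (r + t ℕ.* M)))
    go r q = divides (+ q ℤ.- + t) (trans (cong₂ ℤ._-_ (pos r q) (pos r t))
      (solve 5 (λ c r q t M → (c :+ (r :+ q :* M)) :- (c :+ (r :+ t :* M)) := (q :- t) :* M)
        refl (+ c) (+ r) (+ q) (+ t) (+ M)))

  alike-above : ∀ e t → Alike (+ (suc B + e)) (+ (suc B + (e % M + t ℕ.* M)))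
  alike-above e t = alike same (∣-residue (suc B) e t)
    where
    above : ∀ {d} x → d ℕ.≤ B → d ℕ.< suc B + x
    above x d≤B = s≤s (ℕ.≤-trans d≤B (ℕ.m≤m+n B x))
    same : ∀ c {d} → d ℕ.≤ B →
      ⟦ c ⟧ᶜ (+ (suc B + e)) (+ d) ⇔ ⟦ c ⟧ᶜ (+ (suc B + (e % M + t ℕ.* M))) (+ d)
    same EQ d≤B = mk⇔
      (λ eq → contradiction (sym (ℤ.+-injective eq)) (ℕ.<⇒≢ (above e d≤B)))
      (λ eq → contradiction (sym (ℤ.+-injective eq)) (ℕ.<⇒≢ (above (e % M + t ℕ.* M) d≤B)))
    same NE d≤B = mk⇔
      (λ _ eq → ℕ.<⇒≢ (above (e % M + t ℕ.* M) d≤B) (sym (ℤ.+-injective eq)))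
      (λ _ eq → ℕ.<⇒≢ (above e d≤B) (sym (ℤ.+-injective eq)))
    same LT d≤B = mk⇔
      (λ lt → contradiction (ℤ.drop‿+<+ lt) (ℕ.<-asym (above e d≤B)))
      (λ lt → contradiction (ℤ.drop‿+<+ lt) (ℕ.<-asym (above (e % M + t ℕ.* M) d≤B)))
    same GT d≤B = mk⇔
      (λ _ → ℤ.+<+ (above (e % M + t ℕ.* M) d≤B))
      (λ _ → ℤ.+<+ (above e d≤B))

  alike-below : ∀ e t → Alike -[1+ e ] -[1+ (e % M + t ℕ.* M) ]
  alike-below e t = alike same
    (subst (+ M Signed.∣_)
      (solve 2 (λ i j → i :- j := (:- j) :- (:- i)) refl (+ suc (e % M + t ℕ.* M)) (+ suc e))
      (∣-swap (+ M) (+ suc e) (+ suc (e % M + t ℕ.* M)) (∣-residue 1 e t)))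
    where
    open ℤ-Solver.+-*-Solver
    same : ∀ c {d} → d ℕ.≤ B → ⟦ c ⟧ᶜ -[1+ e ] (+ d) ⇔ ⟦ c ⟧ᶜ -[1+ (e % M + t ℕ.* M) ] (+ d)
    same EQ _ = mk⇔ (λ ()) (λ ())
    same NE _ = mk⇔ (λ _ ()) (λ _ ())
    same LT _ = mk⇔ (λ _ → ℤ.-<+) (λ _ → ℤ.-<+)
    same GT _ = mk⇔ (λ ()) (λ ())

  Finite : Set → Set
  Finite Γ = Σ[ xs ∈ List Γ ] (∀ x → x ∈ xs)

  module _ {Γ : Set} (fin : Finite Γ) where

    total : (Γ → ℤ) → ℕ
    total ρ = sum (map (λ x → ℤ.∣ ρ x ∣) (proj₁ fin))

    ≤-total : ∀ ρ x → ℤ.∣ ρ x ∣ ℕ.≤ total ρ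
    ≤-total ρ x = go (proj₂ fin x)
      where
      go : ∀ {xs} → x ∈ xs → ℤ.∣ ρ x ∣ ℕ.≤ sum (map (λ x → ℤ.∣ ρ x ∣) xs)
      go (here refl)              = ℕ.m≤m+n _ _
      go {y ∷ _} (there x∈) = ℕ.≤-trans (go x∈) (ℕ.m≤n+m _ ℤ.∣ ρ y ∣)

    -- The old values, the constants up to B, and for each residue one value
    -- above and one below all of these.
    candidates : (Γ → ℤ) → List ℤ
    candidates ρ = map ρ (proj₁ fin) ++ map +_ (upTo (suc B)) ++
      map (λ r → + (suc B + (r + total ρ ℕ.* M))) (upTo M) ++
      map (λ r → -[1+ (r + total ρ ℕ.* M) ]) (upTo M)

    fresh : ∀ {ρ i} → total ρ ℕ.< ℤ.∣ i ∣ → ∀ x → i ≢ ρ x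
    fresh {ρ} lt x refl = ℕ.<-irrefl refl (ℕ.<-≤-trans lt (≤-total ρ x))

    candidate : ∀ {ρ ρ′ : Γ → ℤ} → ρ ∼ ρ′ → ∀ i →
      ∃[ j ] j ∈ candidates ρ′ × Alike i j × (∀ x → i ≡ ρ x ⇔ j ≡ ρ′ x)
    candidate {ρ} {ρ′} e i with any? (λ x → i ℤ.≟ ρ x) (proj₁ fin)
    ... | yes any with find any
    ...   | y , y∈ , refl = ρ′ y , ∈-++⁺ˡ (∈-map⁺ ρ′ y∈) , alikeᵛ e y , same-eq e y
    candidate {ρ} {ρ′} e i | no ∉ρ = new i ≢ρ
      where
      ≢ρ : ∀ x → i ≢ ρ x
      ≢ρ x eq = ∉ρ (lose (proj₂ fin x) eq)

      t = total ρ′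

      beyond : ∀ c r → t ℕ.< suc c + (r + t ℕ.* M)
      beyond c r = s≤s (ℕ.≤-trans (ℕ.m≤m*n t M) (ℕ.≤-trans (ℕ.m≤n+m _ r) (ℕ.m≤n+m _ c)))

      apart : ∀ {i j} → (∀ x → i ≢ ρ x) → (∀ x → j ≢ ρ′ x) → ∀ x → i ≡ ρ x ⇔ j ≡ ρ′ x
      apart i≢ j≢ x = mk⇔ (λ eq → contradiction eq (i≢ x)) (λ eq → contradiction eq (j≢ x))

      new : ∀ i → (∀ x → i ≢ ρ x) →
        ∃[ j ] j ∈ candidates ρ′ × Alike i j × (∀ x → i ≡ ρ x ⇔ j ≡ ρ′ x)
      new -[1+ e ] i≢ = -[1+ (e % M + t ℕ.* M) ] ,
        ∈-++⁺ʳ (map ρ′ (proj₁ fin)) (∈-++⁺ʳ (map +_ (upTo (suc B))) (∈-++⁺ʳ (map _ (upTo M))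
          (∈-map⁺ (λ r → -[1+ (r + t ℕ.* M) ]) (∈-upTo⁺ (m%n<n e M))))) ,
        alike-below e t , apart i≢ (fresh (beyond 0 (e % M)))
      new (+ n) i≢ with n ℕ.≤? B
      ... | yes n≤B = + n ,
        ∈-++⁺ʳ (map ρ′ (proj₁ fin)) (∈-++⁺ˡ (∈-map⁺ +_ (∈-upTo⁺ (s≤s n≤B)))) ,
        alike-refl , apart i≢ λ x eq →
          i≢ x (sym (Equivalence.from (same-cmp (alikeᵛ e x) EQ n≤B) (sym eq)))
      ... | no n≰B with ℕ.m≤n⇒∃[o]m+o≡n (ℕ.≰⇒> n≰B)
      ...   | d , refl = + (suc B + (d % M + t ℕ.* M)) ,
        ∈-++⁺ʳ (map ρ′ (proj₁ fin)) (∈-++⁺ʳ (map +_ (upTo (suc B))) (∈-++⁺ˡ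
          (∈-map⁺ (λ r → + (suc B + (r + t ℕ.* M))) (∈-upTo⁺ (m%n<n d M))))) ,
        alike-above d t , apart i≢ (fresh (beyond B (d % M)))

  extend-one : ∀ {Γ} {ρ ρ′ : Γ → ℤ} {i j} → ρ ∼ ρ′ → Alike i j → (∀ x → i ≡ ρ x ⇔ j ≡ ρ′ x) →
    extend ρ (i ∷ []) ∼ extend ρ′ (j ∷ [])
  extend-one {ρ = ρ} {ρ′} {i} {j} e a eq = record { same-eq = same ; alikeᵛ = alikes }
    where
    same : ∀ x y → extend ρ (i ∷ []) x ≡ extend ρ (i ∷ []) y ⇔
                   extend ρ′ (j ∷ []) x ≡ extend ρ′ (j ∷ []) y
    same (inj₁ x)    (inj₁ y)    = same-eq e x y
    same (inj₂ zero) (inj₁ y)    = eq y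
    same (inj₁ x)    (inj₂ zero) =
      mk⇔ (sym ∘ Equivalence.to (eq x) ∘ sym) (sym ∘ Equivalence.from (eq x) ∘ sym)
    same (inj₂ zero) (inj₂ zero) = mk⇔ (λ _ → refl) (λ _ → refl)
    alikes : ∀ x → Alike (extend ρ (i ∷ []) x) (extend ρ′ (j ∷ []) x)
    alikes (inj₁ x)    = alikeᵛ e x
    alikes (inj₂ zero) = a

  finite-⊎ : ∀ {Γ k} → Finite Γ → Finite (Γ ⊎ Fin k)
  finite-⊎ {k = k} (xs , complete) = map inj₁ xs ++ map inj₂ (allFin k) , λ where
    (inj₁ x) → ∈-++⁺ˡ (∈-map⁺ inj₁ (complete x))
    (inj₂ i) → ∈-++⁺ʳ (map inj₁ xs) (∈-map⁺ inj₂ (∈-allFin i))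

  blocks : ∀ {Γ} → Finite Γ → ∀ k → (Γ → ℤ) → List (Vec ℤ k)
  blocks fin zero    ρ = [] ∷ []
  blocks fin (suc k) ρ = concatMap
    (λ i → map (i ∷_) (blocks (finite-⊎ fin) k (extend ρ (i ∷ [])))) (candidates fin ρ)

  block : ∀ {Γ} (fin : Finite Γ) {k} {ρ ρ′ : Γ → ℤ} → ρ ∼ ρ′ → ∀ (xs : Vec ℤ k) →
    ∃[ ys ] ys ∈ blocks fin k ρ′ × (extend ρ xs ∼ extend ρ′ ys)
  block fin e [] = [] , here refl ,
    ∼-pullback (λ { (inj₁ x) → x }) (λ { (inj₁ _) → refl }) (λ { (inj₁ _) → refl }) e
  block {Γ} fin {suc k} {ρ} {ρ′} e (i ∷ xs) with candidate fin e i
  ... | j , j∈ , a , eq with block (finite-⊎ fin) (extend-one e a eq) xs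
  ...   | ys , ys∈ , e′ = j ∷ ys ,
    ∈-concatMap⁺ (λ i → map (i ∷_) (blocks (finite-⊎ fin) k (extend ρ′ (i ∷ []))))
      (lose j∈ (∈-map⁺ (j ∷_) ys∈)) ,
    ∼-pullback split (split-extend ρ i xs) (split-extend ρ′ j ys) e′
    where
    split : Γ ⊎ Fin (suc k) → (Γ ⊎ Fin 1) ⊎ Fin k
    split (inj₁ x)       = inj₁ (inj₁ x)
    split (inj₂ zero)    = inj₁ (inj₂ zero)
    split (inj₂ (suc l)) = inj₂ l
    split-extend : ∀ ρ i xs z → extend (extend ρ (i ∷ [])) xs (split z) ≡ extend ρ (i ∷ xs) z
    split-extend ρ i xs (inj₁ _)       = refl
    split-extend ρ i xs (inj₂ zero)    = refl
    split-extend ρ i xs (inj₂ (suc _)) = refl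

  module _ {Γ : Set} (fin : Finite Γ) {k : ℕ} {ρ : Γ → ℤ} {P : Vec ℤ k → Set}
           (P? : (xs : Vec ℤ k) → Dec (P xs)) where

    search : (∀ {xs ys} → extend ρ xs ∼ extend ρ ys → P xs → P ys) → Dec (∃ P)
    search resp = map′ (λ any → let xs , _ , p = find any in xs , p)
      (λ (xs , p) → let ys , ys∈ , e = block fin ∼-refl xs in lose ys∈ (resp e p))
      (any? P? (blocks fin k ρ))

  module _ {Γ : Set} (fin : Finite Γ) {k : ℕ} {ρ : Γ → ℤ} {P : Vec ℤ k → Set}
           (P? : (xs : Vec ℤ k) → Dec (P xs)) where

    refute : (∀ {xs ys} → extend ρ xs ∼ extend ρ ys → P xs → P ys) →
      (∀ xs → P xs) ⊎ (∃[ xs ] ¬ P xs)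
    refute resp with search fin (¬? ∘ P?) (λ e ¬p p → ¬p (resp (∼-sym e) p))
    ... | yes counterexample = inj₂ counterexample
    ... | no none            = inj₁ λ xs → decidable-stable (P? xs) (λ ¬p → none (xs , ¬p))

-- Labels as Boolean functions

module Progression {m n : ℕ} (ψ : IPCProperty m n) where

  Atom : Set
  Atom = IPC (Var m n)

  s₀ : Label m n
  s₀ = embed ψ

  C-env C-ag : List Atom
  C-env = filter (λ a → ¬? (any? isAgent? (vars a))) (atomsᵖ ψ)
  C-ag  = filter (λ a → any? isAgent? (vars a)) (atomsᵖ ψ)

  overrides : (Atom → Bool) → Val m n → Val m n
  overrides I v = override C-env I (override C-ag I v)

  -- From the leaves as seen after an instant with atom values I back to the
  -- labels as seen at that instant: the successor u of s satisfies
  -- evalᵖ v u ≡ back I v s, whatever the decompositions are.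
  back : (Atom → Bool) → Val m n → Val m n
  back I v (const b)        = b
  back I v (atomᵖ (just a)) = overrides I v (atomᵖ (just a))
  back I v (¬ᵖ (just a))    = not (overrides I v (atomᵖ (just a)))
  back I v (atomᵖ last)     = false
  back I v (¬ᵖ last)        = true
  back I v (𝖷 φ)            = evalᵖ v (xnf φ) ∧ᵇ not (v (atomᵖ last))
  back I v (𝖷ʷ φ)           = evalᵖ v (xnf φ) ∨ᵇ v (atomᵖ last)
  back I v (φ ∧ᵖ χ)         = back I v φ ∧ᵇ back I v χ
  back I v (φ ∨ᵖ χ)         = back I v φ ∨ᵇ back I v χ
  back I v (φ 𝖴 χ)          =
    back I v χ ∨ᵇ (back I v φ ∧ᵇ (evalᵖ v (xnf (φ 𝖴 χ)) ∧ᵇ not (v (atomᵖ last))))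
  back I v (φ 𝖱 χ)          =
    back I v χ ∧ᵇ (back I v φ ∨ᵇ (evalᵖ v (xnf (φ 𝖱 χ)) ∨ᵇ v (atomᵖ last)))

  evalᵖ-back : ∀ I v s → evalᵖ (back I v) s ≡ back I v s
  evalᵖ-back I v (const _)        = refl
  evalᵖ-back I v (atomᵖ _)        = refl
  evalᵖ-back I v (¬ᵖ (just _))    = refl
  evalᵖ-back I v (¬ᵖ last)        = refl
  evalᵖ-back I v (un _ _)         = refl
  evalᵖ-back I v (φ ∧ᵖ χ)         = cong₂ _∧ᵇ_ (evalᵖ-back I v φ) (evalᵖ-back I v χ)
  evalᵖ-back I v (φ ∨ᵖ χ)         = cong₂ _∨ᵇ_ (evalᵖ-back I v φ) (evalᵖ-back I v χ)
  evalᵖ-back I v (_ 𝖴 _)          = refl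
  evalᵖ-back I v (_ 𝖱 _)          = refl

  back-xnf : ∀ I v s → back I v (xnf s) ≡ back I v s
  back-xnf I v (const _) = refl
  back-xnf I v (lit _ _) = refl
  back-xnf I v (un _ _)  = refl
  back-xnf I v (φ ∧ᵖ χ)  = cong₂ _∧ᵇ_ (back-xnf I v φ) (back-xnf I v χ)
  back-xnf I v (φ ∨ᵖ χ)  = cong₂ _∨ᵇ_ (back-xnf I v φ) (back-xnf I v χ)
  back-xnf I v (φ 𝖴 χ)   = cong₂ _∨ᵇ_ (back-xnf I v χ) (cong (_∧ᵇ _) (back-xnf I v φ))
  back-xnf I v (φ 𝖱 χ)   = cong₂ _∧ᵇ_
    (trans (Bool.∨-identityʳ _) (back-xnf I v χ)) (cong (_∨ᵇ _) (back-xnf I v φ))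

  module _ (I : Atom → Bool) (v : Val m n) where

    private
      v₁ v₂ v₃ : Val m n
      v₁ ℓ = evalᵖ v (xnf (rmX ℓ))
      v₂ ℓ = evalᵖ (override C-ag I v₁) (xnf ℓ)
      v₃   = override C-env I v₂

      evalᵖ-v₃ : ∀ s → evalᵖ v₃ (xnf s) ≡ back I v s
      evalᵖ-v₃ (const _)        = refl
      evalᵖ-v₃ (atomᵖ (just _)) = refl
      evalᵖ-v₃ (¬ᵖ (just _))    = refl
      evalᵖ-v₃ (atomᵖ last)     = refl
      evalᵖ-v₃ (¬ᵖ last)        = refl
      evalᵖ-v₃ (𝖷 _)            = refl
      evalᵖ-v₃ (𝖷ʷ _)           = refl
      evalᵖ-v₃ (φ ∧ᵖ χ)         = cong₂ _∧ᵇ_ (evalᵖ-v₃ φ) (evalᵖ-v₃ χ)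
      evalᵖ-v₃ (φ ∨ᵖ χ)         = cong₂ _∨ᵇ_ (evalᵖ-v₃ φ) (evalᵖ-v₃ χ)
      evalᵖ-v₃ (φ 𝖴 χ)          = cong₂ _∨ᵇ_ (evalᵖ-v₃ χ) (cong (_∧ᵇ _) (evalᵖ-v₃ φ))
      evalᵖ-v₃ (φ 𝖱 χ)          = cong₂ _∧ᵇ_
        (trans (Bool.∨-identityʳ _) (evalᵖ-v₃ χ)) (cong (_∨ᵇ _) (evalᵖ-v₃ φ))

    evalᵖ-successor : ∀ {s w t ς u parts parts′} →
      IsDecomposition (xnf s) C-env parts → (w , t) ∈ parts → evalᶠ I w ≡ true →
      IsDecomposition (xnf t) C-ag parts′ → (ς , u) ∈ parts′ → evalᶠ I ς ≡ true →
      evalᵖ v (xnf (rmX u)) ≡ back I v s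
    evalᵖ-successor {s} {t = t} {u = u} dec w∈ eqw dec′ ς∈ eqς = begin
      evalᵖ v (xnf (rmX u))              ≡⟨ evalᵖ-xnf-rmX v u ⟩
      evalᵖ v₁ u                         ≡⟨ evalᵖ-decomp dec′ I v₁ ς∈ eqς ⟨
      evalᵖ (override C-ag I v₁) (xnf t) ≡⟨ evalᵖ-xnf (override C-ag I v₁) t ⟩
      evalᵖ v₂ t                         ≡⟨ evalᵖ-decomp dec I v₂ w∈ eqw ⟨
      evalᵖ v₃ (xnf s)                   ≡⟨ evalᵖ-v₃ s ⟩
      back I v s                         ∎
      where open ≡-Reasoning

  overrides-cong : ∀ I I′ v a → I a ≡ I′ a →
    overrides I v (atomᵖ (just a)) ≡ overrides I′ v (atomᵖ (just a))
  overrides-cong I I′ v a eq with a ∈? C-env | a ∈? C-ag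
  ... | yes _ | _     = eq
  ... | no _  | yes _ = eq
  ... | no _  | no _  = refl

  Lookback-free : Label m n → Set
  Lookback-free s = All LookbackFreeLiteral (tnps s)

  back-lookback-free : ∀ I I′ → (∀ a → ¬ HasLookback a → I a ≡ I′ a) →
    ∀ v s → XNF s → Lookback-free s → back I v s ≡ back I′ v s
  back-lookback-free I I′ eq v (const _) _ _ = refl
  back-lookback-free I I′ eq v (atomᵖ last) _ _ = refl
  back-lookback-free I I′ eq v (¬ᵖ last) _ _ = refl
  back-lookback-free I I′ eq v (atomᵖ (just a)) _ (free ∷ []) =
    overrides-cong I I′ v a (eq a free)
  back-lookback-free I I′ eq v (¬ᵖ (just a)) _ (free ∷ []) =
    cong not (overrides-cong I I′ v a (eq a free))
  back-lookback-free I I′ eq v (𝖷 _) _ _ = refl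
  back-lookback-free I I′ eq v (𝖷ʷ _) _ _ = refl
  back-lookback-free I I′ eq v (φ ∧ᵖ χ) (xφ , xχ) free = cong₂ _∧ᵇ_
    (back-lookback-free I I′ eq v φ xφ (All.++⁻ˡ (tnps φ) free))
    (back-lookback-free I I′ eq v χ xχ (All.++⁻ʳ (tnps φ) free))
  back-lookback-free I I′ eq v (φ ∨ᵖ χ) (xφ , xχ) free = cong₂ _∨ᵇ_
    (back-lookback-free I I′ eq v φ xφ (All.++⁻ˡ (tnps φ) free))
    (back-lookback-free I I′ eq v χ xχ (All.++⁻ʳ (tnps φ) free))

  back-first : WellFormed ψ → ∀ {I I′} → (∀ a → ¬ HasLookback a → I a ≡ I′ a) →
    ∀ v → back I v s₀ ≡ back I′ v s₀
  back-first wf {I} {I′} eq v = begin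
    back I v s₀        ≡⟨ back-xnf I v s₀ ⟨
    back I v (xnf s₀)  ≡⟨ back-lookback-free I I′ eq v (xnf s₀) (xnf-XNF s₀) wf ⟩
    back I′ v (xnf s₀) ≡⟨ back-xnf I′ v s₀ ⟩
    back I′ v s₀       ∎
    where open ≡-Reasoning

  leavesᵗ : Label m n → List (Label m n)
  leavesᵗ (const _)   = []
  leavesᵗ (lit _ _)   = []
  leavesᵗ (un _ φ)    = leaves (xnf φ) ++ leavesᵗ φ
  leavesᵗ (φ ∧ᵖ χ)    = leavesᵗ φ ++ leavesᵗ χ
  leavesᵗ (φ ∨ᵖ χ)    = leavesᵗ φ ++ leavesᵗ χ
  leavesᵗ (φ 𝖴 χ)     = leaves (xnf (φ 𝖴 χ)) ++ leavesᵗ φ ++ leavesᵗ χ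
  leavesᵗ (φ 𝖱 χ)     = leaves (xnf (φ 𝖱 χ)) ++ leavesᵗ φ ++ leavesᵗ χ

  -- The leaves on which labels reachable from s₀ can depend.
  𝓛 : List (Label m n)
  𝓛 = atomᵖ last ∷ leaves s₀ ++ leavesᵗ s₀

  Relevant : Label m n → Set
  Relevant (const _)        = ⊤
  Relevant (lit _ (just a)) = a ∈ atomsᵖ ψ
  Relevant (lit _ last)     = ⊤
  Relevant (un _ φ)         = (∀ {ℓ} → ℓ ∈ leaves (xnf φ) → ℓ ∈ 𝓛) × Relevant φ
  Relevant (φ ∧ᵖ χ)         = Relevant φ × Relevant χ
  Relevant (φ ∨ᵖ χ)         = Relevant φ × Relevant χ
  Relevant (φ 𝖴 χ)          =
    (∀ {ℓ} → ℓ ∈ leaves (xnf (φ 𝖴 χ)) → ℓ ∈ 𝓛) × Relevant φ × Relevant χ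
  Relevant (φ 𝖱 χ)          =
    (∀ {ℓ} → ℓ ∈ leaves (xnf (φ 𝖱 χ)) → ℓ ∈ 𝓛) × Relevant φ × Relevant χ

  relevant-embed : ∀ φ → (∀ {a} → a ∈ atomsᵖ φ → a ∈ atomsᵖ ψ) →
    (∀ {ℓ} → ℓ ∈ leavesᵗ (embed φ) → ℓ ∈ 𝓛) → Relevant (embed φ)
  relevant-embed (const _) _ _ = tt
  relevant-embed (lit _ _) at _ = at (here refl)
  relevant-embed (un _ φ) at lv =
    lv ∘ ∈-++⁺ˡ , relevant-embed φ at (lv ∘ ∈-++⁺ʳ (leaves (xnf (embed φ))))
  relevant-embed (φ ∧ᵖ χ) at lv =
    relevant-embed φ (at ∘ ∈-++⁺ˡ) (lv ∘ ∈-++⁺ˡ) ,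
    relevant-embed χ (at ∘ ∈-++⁺ʳ (atomsᵖ φ)) (lv ∘ ∈-++⁺ʳ (leavesᵗ (embed φ)))
  relevant-embed (φ ∨ᵖ χ) at lv =
    relevant-embed φ (at ∘ ∈-++⁺ˡ) (lv ∘ ∈-++⁺ˡ) ,
    relevant-embed χ (at ∘ ∈-++⁺ʳ (atomsᵖ φ)) (lv ∘ ∈-++⁺ʳ (leavesᵗ (embed φ)))
  relevant-embed (φ 𝖴 χ) at lv =
    lv ∘ ∈-++⁺ˡ ,
    relevant-embed φ (at ∘ ∈-++⁺ˡ) (lv ∘ ∈-++⁺ʳ (leaves (xnf (embed (φ 𝖴 χ)))) ∘ ∈-++⁺ˡ) ,
    relevant-embed χ (at ∘ ∈-++⁺ʳ (atomsᵖ φ))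
      (lv ∘ ∈-++⁺ʳ (leaves (xnf (embed (φ 𝖴 χ)))) ∘ ∈-++⁺ʳ (leavesᵗ (embed φ)))
  relevant-embed (φ 𝖱 χ) at lv =
    lv ∘ ∈-++⁺ˡ ,
    relevant-embed φ (at ∘ ∈-++⁺ˡ) (lv ∘ ∈-++⁺ʳ (leaves (xnf (embed (φ 𝖱 χ)))) ∘ ∈-++⁺ˡ) ,
    relevant-embed χ (at ∘ ∈-++⁺ʳ (atomsᵖ φ))
      (lv ∘ ∈-++⁺ʳ (leaves (xnf (embed (φ 𝖱 χ)))) ∘ ∈-++⁺ʳ (leavesᵗ (embed φ)))

  relevant-s₀ : Relevant s₀
  relevant-s₀ = relevant-embed ψ id (there ∘ ∈-++⁺ʳ (leaves s₀))

  relevant-xnf : ∀ s → Relevant s → Relevant (xnf s)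
  relevant-xnf (const _)        r = r
  relevant-xnf (lit _ _)        r = r
  relevant-xnf (un _ _)         r = r
  relevant-xnf (φ ∧ᵖ χ) (rφ , rχ) = relevant-xnf φ rφ , relevant-xnf χ rχ
  relevant-xnf (φ ∨ᵖ χ) (rφ , rχ) = relevant-xnf φ rφ , relevant-xnf χ rχ
  relevant-xnf (φ 𝖴 χ) r@(lv , rφ , rχ) =
    relevant-xnf χ rχ , relevant-xnf φ rφ , lv , r
  relevant-xnf (φ 𝖱 χ) r@(lv , rφ , rχ) =
    (relevant-xnf χ rχ , tt) , relevant-xnf φ rφ , lv , r

  relevant-leaves : ∀ s → Relevant s → All Relevant (leaves s)
  relevant-leaves (const _)        r = []
  relevant-leaves (lit _ (just _)) r = r ∷ []
  relevant-leaves (lit _ last)     r = tt ∷ []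
  relevant-leaves (un _ _)         r = r ∷ []
  relevant-leaves (φ ∧ᵖ χ) (rφ , rχ) =
    All.++⁺ (relevant-leaves φ rφ) (relevant-leaves χ rχ)
  relevant-leaves (φ ∨ᵖ χ) (rφ , rχ) =
    All.++⁺ (relevant-leaves φ rφ) (relevant-leaves χ rχ)
  relevant-leaves (_ 𝖴 _)          r = r ∷ []
  relevant-leaves (_ 𝖱 _)          r = r ∷ []

  relevant-leaves-xnf : ∀ s → Relevant s → All Relevant (leaves (xnf s))
  relevant-leaves-xnf s r = relevant-leaves (xnf s) (relevant-xnf s r)

  relevant-leavesᵗ : ∀ s → Relevant s → All Relevant (leavesᵗ s)
  relevant-leavesᵗ (const _) _ = []
  relevant-leavesᵗ (lit _ _) _ = []
  relevant-leavesᵗ (un _ φ) (_ , r) = All.++⁺ (relevant-leaves-xnf φ r) (relevant-leavesᵗ φ r)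
  relevant-leavesᵗ (φ ∧ᵖ χ) (rφ , rχ) =
    All.++⁺ (relevant-leavesᵗ φ rφ) (relevant-leavesᵗ χ rχ)
  relevant-leavesᵗ (φ ∨ᵖ χ) (rφ , rχ) =
    All.++⁺ (relevant-leavesᵗ φ rφ) (relevant-leavesᵗ χ rχ)
  relevant-leavesᵗ (φ 𝖴 χ) r@(_ , rφ , rχ) = All.++⁺ (relevant-leaves-xnf (φ 𝖴 χ) r)
    (All.++⁺ (relevant-leavesᵗ φ rφ) (relevant-leavesᵗ χ rχ))
  relevant-leavesᵗ (φ 𝖱 χ) r@(_ , rφ , rχ) = All.++⁺ (relevant-leaves-xnf (φ 𝖱 χ) r)
    (All.++⁺ (relevant-leavesᵗ φ rφ) (relevant-leavesᵗ χ rχ))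

  relevant-𝓛 : All Relevant 𝓛
  relevant-𝓛 = tt ∷ All.++⁺ (relevant-leaves s₀ relevant-s₀) (relevant-leavesᵗ s₀ relevant-s₀)

  Agree : Val m n → Val m n → Set
  Agree v v′ = ∀ {ℓ} → ℓ ∈ 𝓛 → v ℓ ≡ v′ ℓ

  AgreeOnAtoms : (Atom → Bool) → (Atom → Bool) → Set
  AgreeOnAtoms I I′ = ∀ {a} → a ∈ atomsᵖ ψ → I a ≡ I′ a

  overrides-∈ : ∀ I v {a} → a ∈ atomsᵖ ψ → overrides I v (atomᵖ (just a)) ≡ I a
  overrides-∈ I v {a} a∈ with any? isAgent? (vars a)
  ... | yes ag with a ∈? C-env
  ...   | yes _ = refl
  ...   | no _  = override-∈ I v (∈-filter⁺ (λ a → any? isAgent? (vars a)) a∈ ag)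
  overrides-∈ I v {a} a∈ | no ¬ag =
    override-∈ I (override C-ag I v) (∈-filter⁺ (λ a → ¬? (any? isAgent? (vars a))) a∈ ¬ag)

  back-agree : ∀ {I I′ v v′} → AgreeOnAtoms I I′ → Agree v v′ →
    ∀ s → Relevant s → back I v s ≡ back I′ v′ s
  back-agree {I} {I′} {v} {v′} eqI eqv = go
    where
    leaf : ∀ s → (∀ {ℓ} → ℓ ∈ leaves s → ℓ ∈ 𝓛) → evalᵖ v s ≡ evalᵖ v′ s
    leaf s lv = evalᵖ-cong s (eqv ∘ lv)

    atom : ∀ {a} → a ∈ atomsᵖ ψ → overrides I v (atomᵖ (just a)) ≡ overrides I′ v′ (atomᵖ (just a))
    atom a∈ = trans (overrides-∈ I v a∈) (trans (eqI a∈) (sym (overrides-∈ I′ v′ a∈)))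

    eq-last : v (atomᵖ last) ≡ v′ (atomᵖ last)
    eq-last = eqv (here refl)

    go : ∀ s → Relevant s → back I v s ≡ back I′ v′ s
    go (const _) _ = refl
    go (atomᵖ (just a)) r = atom r
    go (¬ᵖ (just a)) r = cong not (atom r)
    go (atomᵖ last) _ = refl
    go (¬ᵖ last) _ = refl
    go (𝖷 φ) (lv , _) = cong₂ _∧ᵇ_ (leaf (xnf φ) lv) (cong not eq-last)
    go (𝖷ʷ φ) (lv , _) = cong₂ _∨ᵇ_ (leaf (xnf φ) lv) eq-last
    go (φ ∧ᵖ χ) (rφ , rχ) = cong₂ _∧ᵇ_ (go φ rφ) (go χ rχ)
    go (φ ∨ᵖ χ) (rφ , rχ) = cong₂ _∨ᵇ_ (go φ rφ) (go χ rχ)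
    go (φ 𝖴 χ) (lv , rφ , rχ) = cong₂ _∨ᵇ_ (go χ rχ)
      (cong₂ _∧ᵇ_ (go φ rφ) (cong₂ _∧ᵇ_ (leaf (xnf (φ 𝖴 χ)) lv) (cong not eq-last)))
    go (φ 𝖱 χ) (lv , rφ , rχ) = cong₂ _∧ᵇ_ (go χ rχ)
      (cong₂ _∨ᵇ_ (go φ rφ) (cong₂ _∨ᵇ_ (leaf (xnf (φ 𝖱 χ)) lv) eq-last))

  agree-back : ∀ {I I′ v v′} → AgreeOnAtoms I I′ → Agree v v′ → Agree (back I v) (back I′ v′)
  agree-back eqI eqv {ℓ} ℓ∈ = back-agree eqI eqv ℓ (All.lookup relevant-𝓛 ℓ∈)

  agree-refl : ∀ {v} → Agree v v
  agree-refl _ = refl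

  State : Set
  State = Val m n → Bool

  ⟪_⟫ : Label m n → State
  ⟪ s ⟫ v = evalᵖ v s

  Determined : State → Set
  Determined f = ∀ {v v′} → Agree v v′ → f v ≡ f v′

  Final : State → Set
  Final f = ∀ v → v (atomᵖ last) ≡ true → f v ≡ true

  step : (Atom → Bool) → State → State
  step I f v = f (back I v)

  determined-s₀ : Determined ⟪ s₀ ⟫
  determined-s₀ eqv = evalᵖ-cong s₀ (λ ℓ∈ → eqv (there (∈-++⁺ˡ ℓ∈)))

  determined-step : ∀ {f} I → Determined f → Determined (step I f)
  determined-step I det eqv = det (agree-back {I} (λ _ → refl) eqv)

  step-cong : ∀ {f I I′} → Determined f → AgreeOnAtoms I I′ → step I f ≗ step I′ f
  step-cong det eqI v = det (agree-back eqI (agree-refl {v}))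

  step-≗ : ∀ {f f′} I → f ≗ f′ → step I f ≗ step I f′
  step-≗ I eq v = eq (back I v)

  samples : List (Label m n) → List (Val m n)
  samples []       = (λ _ → false) ∷ []
  samples (ℓ ∷ ℓs) = concatMap (λ v → update v ℓ true ∷ update v ℓ false ∷ []) (samples ℓs)

  sample : ∀ ℓs (v : Val m n) → ∃[ v′ ] v′ ∈ samples ℓs × (∀ {ℓ} → ℓ ∈ ℓs → v′ ℓ ≡ v ℓ)
  sample [] v = _ , here refl , λ ()
  sample (ℓ ∷ ℓs) v with sample ℓs v
  ... | v′ , v′∈ , eq = update v′ ℓ (v ℓ) ,
      ∈-concatMap⁺ (λ v → update v ℓ true ∷ update v ℓ false ∷ []) (lose v′∈ mem) ,
      λ {ℓ′} ℓ′∈ → sym (update-self v′ v ℓ ℓ′ λ ℓ≢ → sym (eq (∈-tail ℓ≢ ℓ′∈)))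
    where
    mem : update v′ ℓ (v ℓ) ∈ update v′ ℓ true ∷ update v′ ℓ false ∷ []
    mem with v ℓ
    ... | true  = here refl
    ... | false = there (here refl)
    ∈-tail : ∀ {ℓ ℓ′ : Label m n} {ℓs} → ℓ′ ≢ ℓ → ℓ′ ∈ ℓ ∷ ℓs → ℓ′ ∈ ℓs
    ∈-tail ℓ≢ (here eq)   = contradiction eq ℓ≢
    ∈-tail ℓ≢ (there ∈ℓs) = ∈ℓs

  final?ˢ : ∀ {f} → Determined f → Dec (Final f)
  final?ˢ {f} det = map′
    (λ all v eq → let v′ , v′∈ , ag = sample 𝓛 v in
      trans (sym (det ag)) (All.lookup all v′∈ (trans (ag (here refl)) eq)))
    (λ fin → All.universal fin (samples 𝓛))
    (all? (λ v → (v (atomᵖ last) Bool.≟ true) →-dec (f v Bool.≟ true)) (samples 𝓛))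

  DState : Set
  DState = Σ State Determined

  private
    DeterminedBy : List (Label m n) → State → Set
    DeterminedBy ℓs f = ∀ {v v′} → (∀ {ℓ} → ℓ ∈ ℓs → v ℓ ≡ v′ ℓ) → f v ≡ f v′

    branch : Label m n → State → State → State
    branch ℓ f₁ f₀ v = if v ℓ then f₁ v else f₀ v

    functions : (ℓs : List (Label m n)) → List (Σ State (DeterminedBy ℓs))
    functions []       = ((λ _ → true) , λ _ → refl) ∷ ((λ _ → false) , λ _ → refl) ∷ []
    functions (ℓ ∷ ℓs) = cartesianProductWith join (functions ℓs) (functions ℓs)
      where
      join : Σ State (DeterminedBy ℓs) → Σ State (DeterminedBy ℓs) → Σ State (DeterminedBy (ℓ ∷ ℓs))
      join (f₁ , det₁) (f₀ , det₀) = branch ℓ f₁ f₀ , λ eq →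
        cong-branch (eq (here refl)) (det₁ (eq ∘ there)) (det₀ (eq ∘ there))
        where
        cong-branch : ∀ {b b′ c c′ d d′ : Bool} → b ≡ b′ → c ≡ c′ → d ≡ d′ →
          (if b then c else d) ≡ (if b′ then c′ else d′)
        cong-branch refl refl refl = refl

    function : ∀ ℓs f → DeterminedBy ℓs f → ∃[ g ] g ∈ functions ℓs × f ≗ proj₁ g
    function [] f det with f (λ _ → false) in eq
    ... | true  = _ , here refl , λ v → trans (det λ ()) eq
    ... | false = _ , there (here refl) , λ v → trans (det λ ()) eq
    function (ℓ ∷ ℓs) f det
      with function ℓs (λ v → f (update v ℓ true)) (detᵇ true)
         | function ℓs (λ v → f (update v ℓ false)) (detᵇ false)
      where
      detᵇ : ∀ b → DeterminedBy ℓs (λ v → f (update v ℓ b))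
      detᵇ b {v} {v′} eq = det λ {ℓ′} ℓ′∈ → upd ℓ′ ℓ′∈
        where
        upd : ∀ ℓ′ → ℓ′ ∈ ℓ ∷ ℓs → update v ℓ b ℓ′ ≡ update v′ ℓ b ℓ′
        upd ℓ′ ℓ′∈ with Decide._≟_ (Maybe.≡-dec _≟ᴬ_) ℓ′ ℓ | ℓ′∈
        ... | yes _ | _          = refl
        ... | no ℓ≢ | here e     = contradiction e ℓ≢
        ... | no _  | there ℓ′∈ℓs = eq ℓ′∈ℓs
    ... | g₁ , g₁∈ , eq₁ | g₀ , g₀∈ , eq₀ =
      _ , ∈-cartesianProductWith⁺ _ g₁∈ g₀∈ , λ v →
        trans (det λ {ℓ′} _ → update-self v v ℓ ℓ′ λ _ → refl) (select v)
      where
      select : ∀ v → f (update v ℓ (v ℓ)) ≡ branch ℓ (proj₁ g₁) (proj₁ g₀) v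
      select v with v ℓ
      ... | true  = eq₁ v
      ... | false = eq₀ v

  states : List DState
  states = functions 𝓛

  state-∈ : ∀ {f} → Determined f → ∃[ g ] g ∈ states × f ≗ proj₁ g
  state-∈ {f} det = function 𝓛 f det

module _ {A : Set} {P : ℕ → A → Set} (P? : (i : ℕ) (x : A) → Dec (P i x))
         (mono : {i j : ℕ} (x : A) → i ℕ.≤ j → P i x → P j x) where

  -- An element that enters P at stage suc i stays there and can be discarded.
  stabilizes : ∀ i xs → ∃[ K ] i ℕ.≤ K × (∀ {x} → x ∈ xs → P (suc K) x → P K x)
  stabilizes i xs = go (length xs) i xs ℕ.≤-refl
    where
    go : ∀ l i xs → length xs ℕ.≤ l → ∃[ K ] i ℕ.≤ K × (∀ {x} → x ∈ xs → P (suc K) x → P K x)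
    go l i xs len with any? (λ x → P? (suc i) x ×-dec ¬? (P? i x)) xs
    ... | no none = i , ℕ.≤-refl , λ {x} x∈ p →
      decidable-stable (P? i x) λ ¬p → none (lose x∈ (p , ¬p))
    ... | yes some with find some
    ...   | x , x∈ , p , _ with ∈-∃++ x∈
    go zero i _ len | yes some | x , x∈ , p , _ | ys , zs , refl =
      contradiction
        (subst (ℕ._≤ 0) (trans (List.length-++ ys) (ℕ.+-suc (length ys) (length zs))) len) λ ()
    go (suc l) i _ len | yes some | x , x∈ , p , _ | ys , zs , refl
      with go l (suc i) (ys ++ zs) (ℕ.≤-pred (subst (ℕ._≤ suc l)
             (trans (List.length-++ ys) (trans (ℕ.+-suc (length ys) (length zs))
               (cong suc (sym (List.length-++ ys))))) len))
    ... | K , i<K , stable = K , ℕ.<⇒≤ i<K , λ y∈ → [ stable ∘ ∈-++⁺ˡ , tail ]′ (∈-++⁻ ys y∈)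
      where
      tail : ∀ {y} → y ∈ x ∷ zs → P (suc K) y → P K y
      tail (here refl) _ = mono x i<K p
      tail (there y∈)    = stable (∈-++⁺ʳ ys y∈)

-- The game

module Game {m n : ℕ} (ψ : IPCProperty m n) where

  open Progression ψ public

  past : (V m n → ℤ) → Assignment m n → Var m n → ℤ
  past ρ α (now v)    = value α v
  past ρ α (before v) = ρ v

  truth : (V m n → ℤ) → Assignment m n → Atom → Bool
  truth ρ α a = does (⟦ a ⟧ᵃ? (past ρ α))

  -- ρ is the assignment at the previous instant.
  G : ℕ → State → (V m n → ℤ) → Set
  Reply : ℕ → State → (V m n → ℤ) → Vec ℤ m → Set
  G zero    f ρ = Final f
  G (suc i) f ρ = G i f ρ ⊎ (∀ β → Reply i f ρ β)
  Reply i f ρ β = ∃[ γ ] G i (step (truth ρ (β , γ)) f) (value (β , γ))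

  G-mono : ∀ {i j f ρ} → i ℕ.≤ j → G i f ρ → G j f ρ
  G-mono {f = f} {ρ} i≤j p = go (ℕ.≤⇒≤′ i≤j)
    where
    go : ∀ {j} → _ ℕ.≤′ j → G j f ρ
    go ℕ.≤′-refl      = p
    go (ℕ.≤′-step le) = inj₁ (go le)

  unroll : ∀ i {f ρ} → G (suc i) f ρ → Final f ⊎ (∀ β → Reply i f ρ β)
  unroll i       (inj₂ reply) = inj₂ reply
  unroll zero    (inj₁ final) = inj₁ final
  unroll (suc i) (inj₁ p) with unroll i p
  ... | inj₁ final = inj₁ final
  ... | inj₂ reply = inj₂ λ β → let γ , q = reply β in γ , inj₁ q

  final-≗ : ∀ {f f′} → f ≗ f′ → Final f → Final f′
  final-≗ eq final v is-last = trans (sym (eq v)) (final v is-last)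

  G-≗ : ∀ i {f f′ ρ} → f ≗ f′ → G i f ρ → G i f′ ρ
  G-≗ zero    eq final     = final-≗ eq final
  G-≗ (suc i) eq (inj₁ p)  = inj₁ (G-≗ i eq p)
  G-≗ (suc i) {ρ = ρ} eq (inj₂ r) = inj₂ λ β → let γ , p = r β in
    γ , G-≗ i (step-≗ (truth ρ (β , γ)) eq) p

  private
    bounds = fit-all (atomsᵖ ψ)
    B = proj₁ bounds
    M = proj₁ (proj₂ bounds)

    fits : All (Fits B M) (atomsᵖ ψ)
    fits = proj₂ (proj₂ (proj₂ bounds))

    instance
      M≢0 : NonZero M
      M≢0 = proj₁ (proj₂ (proj₂ bounds))

  open Similarity B M

  finite-⊥ : Finite ⊥
  finite-⊥ = [] , λ ()

  finite-V : Finite (V m n)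
  finite-V = finite-⊎ (allFin m , ∈-allFin)

  private
    slot : Var m n → (V m n ⊎ Fin m) ⊎ Fin n
    slot (now (inj₁ x)) = inj₁ (inj₂ x)
    slot (now (inj₂ y)) = inj₂ y
    slot (before v)     = inj₁ (inj₁ v)

    slot-past : ∀ ρ β γ z → extend (extend ρ β) γ (slot z) ≡ past ρ (β , γ) z
    slot-past ρ β γ (now (inj₁ x)) = refl
    slot-past ρ β γ (now (inj₂ y)) = refl
    slot-past ρ β γ (before v)     = refl

  module _ {ρ ρ′ : V m n → ℤ} {β β′ : Vec ℤ m} {γ γ′ : Vec ℤ n}
           (e : extend (extend ρ β) γ ∼ extend (extend ρ′ β′) γ′) where

    ∼-past : past ρ (β , γ) ∼ past ρ′ (β′ , γ′)
    ∼-past = ∼-pullback slot (slot-past ρ β γ) (slot-past ρ′ β′ γ′) e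

    ∼-value : value (β , γ) ∼ value (β′ , γ′)
    ∼-value = ∼-pullback inj₁ (λ _ → refl) (λ _ → refl) ∼-past

    ∼-truth : AgreeOnAtoms (truth ρ (β , γ)) (truth ρ′ (β′ , γ′))
    ∼-truth {a} a∈ = does-⇔
      (mk⇔ (∼-sound ∼-past a (All.lookup fits a∈)) (∼-sound (∼-sym ∼-past) a (All.lookup fits a∈)))
      (⟦ a ⟧ᵃ? _) (⟦ a ⟧ᵃ? _)

  G-resp : ∀ i {f ρ ρ′} → Determined f → ρ ∼ ρ′ → G i f ρ → G i f ρ′
  round-resp : ∀ i {f ρ ρ′ β β′ γ γ′} → Determined f →
    extend (extend ρ β) γ ∼ extend (extend ρ′ β′) γ′ →
    G i (step (truth ρ (β , γ)) f) (value (β , γ)) →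
    G i (step (truth ρ′ (β′ , γ′)) f) (value (β′ , γ′))
  reply-resp : ∀ i {f ρ ρ′ β β′} → Determined f → extend ρ β ∼ extend ρ′ β′ →
    Reply i f ρ β → Reply i f ρ′ β′

  G-resp zero    det e final     = final
  G-resp (suc i) det e (inj₁ p)  = inj₁ (G-resp i det e p)
  G-resp (suc i) det e (inj₂ r) = inj₂ λ β′ →
    let β , _ , e′ = block finite-V (∼-sym e) β′ in reply-resp i det (∼-sym e′) (r β)

  round-resp i {ρ = ρ} {β = β} {γ = γ} det e p =
    G-≗ i (step-cong det (∼-truth e))
      (G-resp i (determined-step (truth ρ (β , γ)) det) (∼-value e) p)

  reply-resp i det e (γ , p) =
    let γ′ , _ , e′ = block (finite-⊎ finite-V) e γ in γ′ , round-resp i det e′ p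

  G? : ∀ i {f} → Determined f → ∀ ρ → Dec (G i f ρ)
  Reply? : ∀ i {f} → Determined f → ∀ ρ β → Dec (Reply i f ρ β)
  G? zero    det ρ = final?ˢ det
  G? (suc i) det ρ with G? i det ρ | refute finite-V (Reply? i det ρ) (reply-resp i det)
  ... | yes p | _                    = yes (inj₁ p)
  ... | no _  | inj₁ reply           = yes (inj₂ reply)
  ... | no ¬p | inj₂ (β , no-reply)  = no [ ¬p , (λ reply → no-reply (reply β)) ]′
  Reply? i det ρ β = search (finite-⊎ finite-V)
    (λ γ → G? i (determined-step (truth ρ (β , γ)) det) (value (β , γ))) (round-resp i det)

  abstract

    no-reply : ∀ i {f ρ} → Determined f → ¬ G (suc i) f ρ → ∃[ β ] ¬ Reply i f ρ β
    no-reply i {ρ = ρ} det ¬g with refute finite-V (Reply? i det ρ) (reply-resp i det)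
    ... | inj₁ reply = contradiction (inj₂ reply) ¬g
    ... | inj₂ move  = move

  assignments : List (V m n → ℤ)
  assignments = concatMap
    (λ β → map (λ γ → value (β , γ)) (blocks (finite-⊎ finite-⊥) n (extend ⊥-elim β)))
    (blocks finite-⊥ m ⊥-elim)

  representative : ∀ ρ → ∃[ ρ′ ] ρ′ ∈ assignments × ρ ∼ ρ′
  representative ρ with block finite-⊥ {ρ = ⊥-elim} ∼-refl (tabulate (ρ ∘ inj₁))
  ... | β , β∈ , e with block (finite-⊎ finite-⊥) e (tabulate (ρ ∘ inj₂))
  ...   | γ , γ∈ , e′ = value (β , γ) ,
    ∈-concatMap⁺ _ (lose β∈ (∈-map⁺ (λ γ → value (β , γ)) γ∈)) ,
    ∼-pullback (λ { (inj₁ x) → inj₁ (inj₂ x) ; (inj₂ y) → inj₂ y })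
      (λ { (inj₁ x) → Vec.lookup∘tabulate (ρ ∘ inj₁) x
         ; (inj₂ y) → Vec.lookup∘tabulate (ρ ∘ inj₂) y })
      (λ { (inj₁ x) → refl ; (inj₂ y) → refl }) e′

  ∃G? : ∀ i {f} → Determined f → Dec (∃[ ρ ] G i f ρ)
  ∃G? i det = map′ (λ any → let ρ , _ , p = find any in ρ , p)
    (λ (ρ , p) → let ρ′ , ρ′∈ , e = representative ρ in lose ρ′∈ (G-resp i det e p))
    (any? (G? i det) assignments)

  Stable : ℕ → Set
  Stable K = ∀ {f ρ} → Determined f → G (suc K) f ρ → G K f ρ

  stable : ∃[ K ] Stable K
  stable = K , λ {f} {ρ} det p →
    let g , g∈ , eq = state-∈ det
        ρ′ , ρ′∈ , e = representative ρ
    in G-≗ K (sym ∘ eq) (G-resp K (proj₂ g) (∼-sym e)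
         (on-positions (∈-cartesianProduct⁺ g∈ ρ′∈)
           (G-≗ (suc K) eq (G-resp (suc K) det e p))))
    where
    Pos : ℕ → DState × (V m n → ℤ) → Set
    Pos i ((f , _) , ρ) = G i f ρ
    limit = stabilizes {P = Pos} (λ i ((_ , det) , ρ) → G? i det ρ)
      (λ _ i≤j → G-mono i≤j) 0 (cartesianProduct states assignments)
    K = proj₁ limit
    on-positions = proj₂ (proj₂ limit)

  absorb : ∀ {K} → Stable K → ∀ j {f ρ} → Determined f → G j f ρ → G K f ρ
  absorb {K} st j det p = go j det (G-mono (ℕ.m≤m+n j K) p)
    where
    go : ∀ j {f ρ} → Determined f → G (j + K) f ρ → G K f ρ
    go zero    det p        = p
    go (suc j) det (inj₁ p) = go j det p
    go (suc j) {ρ = ρ} det (inj₂ r) = st det (inj₂ λ β → let γ , p = r β in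
      γ , go j (determined-step (truth ρ (β , γ)) det) p)

-- Traces and strategies

reflects-map : ∀ {P Q : Set} {b} → P ⇔ Q → Reflects P b → Reflects Q b
reflects-map e (ofʸ p)  = ofʸ (Equivalence.to e p)
reflects-map e (ofⁿ ¬p) = ofⁿ (¬p ∘ Equivalence.from e)

reflects-true : ∀ {P : Set} {b} → Reflects P b → P ⇔ b ≡ true
reflects-true (ofʸ p)  = mk⇔ (λ _ → refl) (λ _ → p)
reflects-true (ofⁿ ¬p) = mk⇔ (λ p → contradiction p ¬p) (λ ())

holds? : ∀ {m n} p (α : Assignment m n) a → Dec (holds p α a)
holds? nothing   α a = any? isLookback? (vars a) ⊎-dec ⟦ a ⟧ᵃ? (env α α)
  where
  isLookback? : ∀ {m n} (z : Var m n) → Dec (IsLookback z)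
  isLookback? (now _)    = no λ ()
  isLookback? (before _) = yes tt
holds? (just α⁻) α a = ⟦ a ⟧ᵃ? (env α⁻ α)

module _ {m n : ℕ} {N : ℕ} {σ : ℕ → Assignment m n} where

  𝖴-unfold : ∀ {i} φ χ → i ℕ.< N → (N , σ , i ⊨ (χ ∨ᵖ (φ ∧ᵖ 𝖷 (φ 𝖴 χ)))) ⇔ (N , σ , i ⊨ (φ 𝖴 χ))
  𝖴-unfold {i} φ χ i<N = mk⇔ to from
    where
    to : N , σ , i ⊨ (χ ∨ᵖ (φ ∧ᵖ 𝖷 (φ 𝖴 χ))) → N , σ , i ⊨ (φ 𝖴 χ)
    to (inj₁ now-χ) = i , ℕ.≤-refl , i<N , now-χ , λ l i≤l l<i → contradiction i≤l (ℕ.<⇒≱ l<i)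
    to (inj₂ (now-φ , _ , j , i<j , j<N , at-χ , until)) = j , ℕ.<⇒≤ i<j , j<N , at-χ , before-j
      where
      before-j : ∀ l → i ℕ.≤ l → l ℕ.< j → N , σ , l ⊨ φ
      before-j l i≤l l<j with ℕ.m≤n⇒m<n∨m≡n i≤l
      ... | inj₁ i<l  = until l i<l l<j
      ... | inj₂ refl = now-φ
    from : N , σ , i ⊨ (φ 𝖴 χ) → N , σ , i ⊨ (χ ∨ᵖ (φ ∧ᵖ 𝖷 (φ 𝖴 χ)))
    from (j , i≤j , j<N , at-χ , until) with ℕ.m≤n⇒m<n∨m≡n i≤j
    ... | inj₂ refl = inj₁ at-χ
    ... | inj₁ i<j  = inj₂ (until i ℕ.≤-refl i<j , ℕ.≤-<-trans i<j j<N ,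
      j , i<j , j<N , at-χ , λ l i<l → until l (ℕ.<⇒≤ i<l))

  𝖱-unfold : ∀ {i} φ χ → i ℕ.< N → (N , σ , i ⊨ (χ ∧ᵖ (φ ∨ᵖ 𝖷ʷ (φ 𝖱 χ)))) ⇔ (N , σ , i ⊨ (φ 𝖱 χ))
  𝖱-unfold {i} φ χ i<N = mk⇔ to from
    where
    to : N , σ , i ⊨ (χ ∧ᵖ (φ ∨ᵖ 𝖷ʷ (φ 𝖱 χ))) → N , σ , i ⊨ (φ 𝖱 χ)
    to (now-χ , inj₁ now-φ) = inj₂ (i , ℕ.≤-refl , i<N , now-φ , λ l i≤l l≤i →
      subst (λ l → N , σ , l ⊨ χ) (ℕ.≤-antisym i≤l l≤i) now-χ)
    to (now-χ , inj₂ (inj₁ end)) = inj₁ λ j i≤j j<N →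
      subst (λ j → N , σ , j ⊨ χ) (ℕ.≤-antisym i≤j (ℕ.≤-pred (subst (j ℕ.<_) (sym end) j<N))) now-χ
    to (now-χ , inj₂ (inj₂ (inj₁ always))) = inj₁ from-i
      where
      from-i : ∀ j → i ℕ.≤ j → j ℕ.< N → N , σ , j ⊨ χ
      from-i j i≤j j<N with ℕ.m≤n⇒m<n∨m≡n i≤j
      ... | inj₁ i<j  = always j i<j j<N
      ... | inj₂ refl = now-χ
    to (now-χ , inj₂ (inj₂ (inj₂ (j , i<j , j<N , at-φ , up-to)))) =
      inj₂ (j , ℕ.<⇒≤ i<j , j<N , at-φ , from-i)
      where
      from-i : ∀ l → i ℕ.≤ l → l ℕ.≤ j → N , σ , l ⊨ χ
      from-i l i≤l l≤j with ℕ.m≤n⇒m<n∨m≡n i≤l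
      ... | inj₁ i<l  = up-to l i<l l≤j
      ... | inj₂ refl = now-χ
    from : N , σ , i ⊨ (φ 𝖱 χ) → N , σ , i ⊨ (χ ∧ᵖ (φ ∨ᵖ 𝖷ʷ (φ 𝖱 χ)))
    from (inj₁ always) =
      always i ℕ.≤-refl i<N , inj₂ (inj₂ (inj₁ λ j i<j → always j (ℕ.<⇒≤ i<j)))
    from (inj₂ (j , i≤j , j<N , at-φ , up-to)) with ℕ.m≤n⇒m<n∨m≡n i≤j
    ... | inj₂ refl = up-to i ℕ.≤-refl ℕ.≤-refl , inj₁ at-φ
    ... | inj₁ i<j  = up-to i ℕ.≤-refl i≤j ,
      inj₂ (inj₂ (inj₂ (j , i<j , j<N , at-φ , λ l i<l → up-to l (ℕ.<⇒≤ i<l))))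

module Semantics {m n : ℕ} (ψ : IPCProperty m n) where

  open Game ψ public

  -- Truth at instant i of a trace of length i + suc r.
  sem : (ℕ → Atom → Bool) → ℕ → ℕ → Val m n
  semˣ semʷ : (ℕ → Atom → Bool) → ℕ → ℕ → Val m n
  sem I r i (const b)        = b
  sem I r i (atomᵖ (just a)) = I i a
  sem I r i (¬ᵖ (just a))    = not (I i a)
  sem I r i (atomᵖ last)     = false
  sem I r i (¬ᵖ last)        = true
  sem I r i (𝖷 φ)            = semˣ I r i φ
  sem I r i (𝖷ʷ φ)           = semʷ I r i φ
  sem I r i (φ ∧ᵖ χ)         = sem I r i φ ∧ᵇ sem I r i χ
  sem I r i (φ ∨ᵖ χ)         = sem I r i φ ∨ᵇ sem I r i χ
  sem I r i (φ 𝖴 χ)          = sem I r i χ ∨ᵇ (sem I r i φ ∧ᵇ semˣ I r i (φ 𝖴 χ))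
  sem I r i (φ 𝖱 χ)          = sem I r i χ ∧ᵇ (sem I r i φ ∨ᵇ semʷ I r i (φ 𝖱 χ))
  semˣ I zero    i φ = false
  semˣ I (suc r) i φ = sem I r (suc i) φ
  semʷ I zero    i φ = true
  semʷ I (suc r) i φ = sem I r (suc i) φ

  evalᵖ-sem-xnf : ∀ I r i s → evalᵖ (sem I r i) (xnf s) ≡ sem I r i s
  evalᵖ-sem-xnf I r i (const _)        = refl
  evalᵖ-sem-xnf I r i (atomᵖ _)        = refl
  evalᵖ-sem-xnf I r i (¬ᵖ (just _))    = refl
  evalᵖ-sem-xnf I r i (¬ᵖ last)        = refl
  evalᵖ-sem-xnf I r i (un _ _)         = refl
  evalᵖ-sem-xnf I r i (φ ∧ᵖ χ) = cong₂ _∧ᵇ_ (evalᵖ-sem-xnf I r i φ) (evalᵖ-sem-xnf I r i χ)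
  evalᵖ-sem-xnf I r i (φ ∨ᵖ χ) = cong₂ _∨ᵇ_ (evalᵖ-sem-xnf I r i φ) (evalᵖ-sem-xnf I r i χ)
  evalᵖ-sem-xnf I r i (φ 𝖴 χ)  =
    cong₂ _∨ᵇ_ (evalᵖ-sem-xnf I r i χ) (cong (_∧ᵇ semˣ I r i (φ 𝖴 χ)) (evalᵖ-sem-xnf I r i φ))
  evalᵖ-sem-xnf I r i (φ 𝖱 χ)  = cong₂ _∧ᵇ_
    (trans (Bool.∨-identityʳ _) (evalᵖ-sem-xnf I r i χ))
    (cong (_∨ᵇ semʷ I r i (φ 𝖱 χ)) (evalᵖ-sem-xnf I r i φ))

  with-last : Val m n → Val m n
  with-last v (atomᵖ last) = true
  with-last v ℓ            = v ℓ

  evalᵖ-with-last : ∀ v φ → evalᵖ (with-last v) (embed φ) ≡ evalᵖ v (embed φ)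
  evalᵖ-with-last v (const _) = refl
  evalᵖ-with-last v (atomᵖ _) = refl
  evalᵖ-with-last v (¬ᵖ _)    = refl
  evalᵖ-with-last v (un _ _)  = refl
  evalᵖ-with-last v (φ ∧ᵖ χ)  = cong₂ _∧ᵇ_ (evalᵖ-with-last v φ) (evalᵖ-with-last v χ)
  evalᵖ-with-last v (φ ∨ᵖ χ)  = cong₂ _∨ᵇ_ (evalᵖ-with-last v φ) (evalᵖ-with-last v χ)
  evalᵖ-with-last v (_ 𝖴 _)   = refl
  evalᵖ-with-last v (_ 𝖱 _)   = refl

  evalᵖ-sem : ∀ I r i φ → evalᵖ (sem I r i) (embed φ) ≡ sem I r i (embed φ)
  evalᵖ-sem I r i (const _) = refl
  evalᵖ-sem I r i (atomᵖ _) = refl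
  evalᵖ-sem I r i (¬ᵖ _)    = refl
  evalᵖ-sem I r i (un _ _)  = refl
  evalᵖ-sem I r i (φ ∧ᵖ χ)  = cong₂ _∧ᵇ_ (evalᵖ-sem I r i φ) (evalᵖ-sem I r i χ)
  evalᵖ-sem I r i (φ ∨ᵖ χ)  = cong₂ _∨ᵇ_ (evalᵖ-sem I r i φ) (evalᵖ-sem I r i χ)
  evalᵖ-sem I r i (_ 𝖴 _)   = refl
  evalᵖ-sem I r i (_ 𝖱 _)   = refl

  module _ (I : ℕ → Atom → Bool) where

    -- What v must satisfy to describe the instant after i, if any.
    Describes : Val m n → ℕ → ℕ → Set
    Describes v r i =
      (∀ χ → evalᵖ v (xnf χ) ∧ᵇ not (v (atomᵖ last)) ≡ semˣ I r i χ) ×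
      (∀ χ → evalᵖ v (xnf χ) ∨ᵇ v (atomᵖ last) ≡ semʷ I r i χ)

    describes-end : ∀ {v} i → v (atomᵖ last) ≡ true → Describes v 0 i
    describes-end i eq rewrite eq = (λ _ → Bool.∧-zeroʳ _) , (λ _ → Bool.∨-zeroʳ _)

    describes-next : ∀ r i → Describes (sem I r (suc i)) (suc r) i
    describes-next r i =
      (λ χ → trans (Bool.∧-identityʳ _) (evalᵖ-sem-xnf I r (suc i) χ)) ,
      (λ χ → trans (Bool.∨-identityʳ _) (evalᵖ-sem-xnf I r (suc i) χ))

    back-sem : ∀ {v r i} → Describes v r i → ∀ s → Relevant s → back (I i) v s ≡ sem I r i s
    back-sem {v} {r} {i} (next , wnext) = go
      where
      go : ∀ s → Relevant s → back (I i) v s ≡ sem I r i s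
      go (const _) _ = refl
      go (atomᵖ (just a)) a∈ = overrides-∈ (I i) v a∈
      go (¬ᵖ (just a)) a∈ = cong not (overrides-∈ (I i) v a∈)
      go (atomᵖ last) _ = refl
      go (¬ᵖ last) _ = refl
      go (𝖷 φ) _ = next φ
      go (𝖷ʷ φ) _ = wnext φ
      go (φ ∧ᵖ χ) (rφ , rχ) = cong₂ _∧ᵇ_ (go φ rφ) (go χ rχ)
      go (φ ∨ᵖ χ) (rφ , rχ) = cong₂ _∨ᵇ_ (go φ rφ) (go χ rχ)
      go (φ 𝖴 χ) (_ , rφ , rχ) =
        cong₂ _∨ᵇ_ (go χ rχ) (cong₂ _∧ᵇ_ (go φ rφ) (next (φ 𝖴 χ)))
      go (φ 𝖱 χ) (_ , rφ , rχ) =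
        cong₂ _∧ᵇ_ (go χ rχ) (cong₂ _∨ᵇ_ (go φ rφ) (wnext (φ 𝖱 χ)))

    agree-sem : ∀ {v r i} → Describes v r i → Agree (back (I i) v) (sem I r i)
    agree-sem d {ℓ} ℓ∈ = back-sem d ℓ (All.lookup relevant-𝓛 ℓ∈)

  run : State → (ℕ → Atom → Bool) → ℕ → ℕ → State
  run f I i zero    = f
  run f I i (suc k) = run (step (I i) f) I (suc i) k

  determined-run : ∀ {f} I i k → Determined f → Determined (run f I i k)
  determined-run I i zero    det = det
  determined-run I i (suc k) det = determined-run I (suc i) k (determined-step (I i) det)

  run-shift : ∀ f I i k → run f I (suc i) k ≡ run f (I ∘ suc) i k
  run-shift f I i zero    = refl
  run-shift f I i (suc k) = run-shift (step (I (suc i)) f) I (suc i) k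

  run-cong : ∀ {f f′ I I′} i k → Determined f → f ≗ f′ →
    (∀ j → i ℕ.≤ j → AgreeOnAtoms (I j) (I′ j)) → run f I i k ≗ run f′ I′ i k
  run-cong i zero det eq eqI = eq
  run-cong {I = I} {I′} i (suc k) det eq eqI =
    run-cong (suc i) k (determined-step (I i) det)
      (λ v → trans (step-cong det (eqI i ℕ.≤-refl) v) (step-≗ (I′ i) eq v))
      (λ j i<j → eqI j (ℕ.<⇒≤ i<j))

  run-sem : ∀ {f} I r i → Determined f → ∀ v → v (atomᵖ last) ≡ true →
    run f I i (suc r) v ≡ f (sem I r i)
  run-sem I zero    i det v eq = det (agree-sem I (describes-end I i eq))
  run-sem I (suc r) i det v eq = trans (run-sem I r (suc i) (determined-step (I i) det) v eq)
    (det (agree-sem I (describes-next I r i)))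

  truthᵗ : (ℕ → Assignment m n) → ℕ → Atom → Bool
  truthᵗ σ i a = does (holds? (previous σ i) (σ i) a)

  sem-reflects : ∀ σ {N} r i φ → suc r + i ≡ N →
    Reflects (N , σ , i ⊨ φ) (sem (truthᵗ σ) r i (embed φ))
  semˣ-reflects : ∀ σ {N} r i φ → suc r + i ≡ N →
    Reflects (N , σ , i ⊨ 𝖷 φ) (semˣ (truthᵗ σ) r i (embed φ))
  semʷ-reflects : ∀ σ {N} r i φ → suc r + i ≡ N →
    Reflects (N , σ , i ⊨ 𝖷ʷ φ) (semʷ (truthᵗ σ) r i (embed φ))
  sem-reflects σ r i ⊤ᵖ       eq = ofʸ tt
  sem-reflects σ r i ⊥ᵖ       eq = ofⁿ id
  sem-reflects σ r i (atomᵖ a) eq = proof (holds? (previous σ i) (σ i) a)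
  sem-reflects σ r i (¬ᵖ a)    eq = ¬-reflects (proof (holds? (previous σ i) (σ i) a))
  sem-reflects σ r i (𝖷 φ)    eq = semˣ-reflects σ r i φ eq
  sem-reflects σ r i (𝖷ʷ φ)   eq = semʷ-reflects σ r i φ eq
  sem-reflects σ r i (φ ∧ᵖ χ) eq = sem-reflects σ r i φ eq ×-reflects sem-reflects σ r i χ eq
  sem-reflects σ r i (φ ∨ᵖ χ) eq = sem-reflects σ r i φ eq ⊎-reflects sem-reflects σ r i χ eq
  sem-reflects σ r i (φ 𝖴 χ)  eq =
    reflects-map (𝖴-unfold φ χ (subst (i ℕ.<_) eq (s≤s (ℕ.m≤n+m i r))))
      (sem-reflects σ r i χ eq ⊎-reflects
        (sem-reflects σ r i φ eq ×-reflects semˣ-reflects σ r i (φ 𝖴 χ) eq))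
  sem-reflects σ r i (φ 𝖱 χ)  eq =
    reflects-map (𝖱-unfold φ χ (subst (i ℕ.<_) eq (s≤s (ℕ.m≤n+m i r))))
      (sem-reflects σ r i χ eq ×-reflects
        (sem-reflects σ r i φ eq ⊎-reflects semʷ-reflects σ r i (φ 𝖱 χ) eq))
  semˣ-reflects σ zero i φ refl = ofⁿ λ (lt , _) → ℕ.<-irrefl refl lt
  semˣ-reflects σ (suc r) i φ refl =
    reflects-map (mk⇔ (λ p → s≤s (s≤s (ℕ.m≤n+m i r)) , p) proj₂)
      (sem-reflects σ r (suc i) φ (cong suc (ℕ.+-suc r i)))
  semʷ-reflects σ zero i φ refl = ofʸ (inj₁ refl)
  semʷ-reflects σ (suc r) i φ refl =
    reflects-map (mk⇔ inj₂ [ (λ eq → contradiction eq (ℕ.<⇒≢ (s≤s (s≤s (ℕ.m≤n+m i r))))) , id ]′)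
      (sem-reflects σ r (suc i) φ (cong suc (ℕ.+-suc r i)))

  ⊨⇔sem : ∀ σ r → (suc r , σ , 0 ⊨ ψ) ⇔ ⟪ s₀ ⟫ (sem (truthᵗ σ) r 0) ≡ true
  ⊨⇔sem σ r = subst (λ b → (suc r , σ , 0 ⊨ ψ) ⇔ b ≡ true) (sym (evalᵖ-sem (truthᵗ σ) r 0 ψ))
    (reflects-true (sem-reflects σ r 0 ψ (ℕ.+-identityʳ (suc r))))

  ⊨⇔final : ∀ σ r → (suc r , σ , 0 ⊨ ψ) ⇔ Final (run ⟪ s₀ ⟫ (truthᵗ σ) 0 (suc r))
  ⊨⇔final σ r = mk⇔
    (λ sat v eq → trans (run-sem (truthᵗ σ) r 0 determined-s₀ v eq)
      (Equivalence.to (⊨⇔sem σ r) sat))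
    (λ final → Equivalence.from (⊨⇔sem σ r)
      (trans (sym (run-sem (truthᵗ σ) r 0 determined-s₀ (λ _ → true) refl)) (final _ refl)))

  final-s₀-⊨ : Final ⟪ s₀ ⟫ → ∀ σ → 1 , σ , 0 ⊨ ψ
  final-s₀-⊨ final σ = Equivalence.from (⊨⇔sem σ 0)
    (trans (sym (evalᵖ-with-last (sem (truthᵗ σ) 0 0) ψ)) (final _ refl))

  final-⊨ : ∀ σ k → Final (run ⟪ s₀ ⟫ (truthᵗ σ) 0 k) → ∃[ j ] (suc j , σ , 0 ⊨ ψ)
  final-⊨ σ zero    final = 0 , final-s₀-⊨ final σ
  final-⊨ σ (suc k) final = k , Equivalence.from (⊨⇔final σ k) final

  Env-strategy Agent-strategy : Set
  Env-strategy   = ℕ → Vec ℤ m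
  Agent-strategy = List (Vec ℤ m) → Vec ℤ n

  Wins : ℕ → Agent-strategy → Set
  Wins K h = ∀ π k → let σ = play h π; f = run ⟪ s₀ ⟫ (truthᵗ σ) 0 in
    (∀ j → j ℕ.≤ k → ¬ Final (f j)) → G (K ∸ k) (f (suc k)) (value (σ k))

  wins-realizes : ∀ {K} h → Wins K h → Realizes h ψ
  wins-realizes {K} h wins π
    with ℕ.anyUpTo? (λ j → final?ˢ (determined-run I 0 j determined-s₀)) (suc K)
    where I = truthᵗ (play h π)
  ... | yes (j , _ , final) = final-⊨ (play h π) j final
  ... | no none = final-⊨ (play h π) (suc K)
    (subst (λ i → G i (run ⟪ s₀ ⟫ (truthᵗ (play h π)) 0 (suc K)) (value (play h π K))) (ℕ.n∸n≡0 K)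
      (wins π K λ j j≤K final → none (j , s≤s j≤K , final)))

  before-first : (V m n → ℤ) → (ℕ → Assignment m n) → ℕ → V m n → ℤ
  before-first ρ σ zero    = ρ
  before-first ρ σ (suc i) = before-first (value (σ 0)) (σ ∘ suc) i

  truthʳ : (V m n → ℤ) → (ℕ → Assignment m n) → ℕ → Atom → Bool
  truthʳ ρ σ i = truth (before-first ρ σ i) (σ i)

  before-first-suc : ∀ ρ σ i → before-first ρ σ (suc i) ≡ value (σ i)
  before-first-suc ρ σ zero    = refl
  before-first-suc ρ σ (suc i) = before-first-suc (value (σ 0)) (σ ∘ suc) i

  env-past : ∀ α⁻ α z → env α⁻ α z ≡ past (value α⁻) α z
  env-past α⁻ α (now _)    = refl
  env-past α⁻ α (before _) = refl

  truthᵗ-suc : ∀ ρ σ i a → truthᵗ σ (suc i) a ≡ truthʳ ρ σ (suc i) a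
  truthᵗ-suc ρ σ i a rewrite before-first-suc ρ σ i = does-⇔
    (mk⇔ (⟦⟧ᵃ-cong a (All.universal (env-past (σ i) (σ (suc i))) (vars a)))
         (⟦⟧ᵃ-cong a (All.universal (sym ∘ env-past (σ i) (σ (suc i))) (vars a))))
    (⟦ a ⟧ᵃ? _) (⟦ a ⟧ᵃ? _)

  truthᵗ-zero : ∀ ρ σ a → ¬ HasLookback a → truthᵗ σ 0 a ≡ truthʳ ρ σ 0 a
  truthᵗ-zero ρ σ a free = does-⇔
    (mk⇔ [ (λ lookback → contradiction lookback free) , ⟦⟧ᵃ-cong a same ]′
         (inj₂ ∘ ⟦⟧ᵃ-cong a (All.map sym same)))
    (holds? nothing (σ 0) a) (⟦ a ⟧ᵃ? _)
    where
    same : All (λ z → env (σ 0) (σ 0) z ≡ past ρ (σ 0) z) (vars a)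
    same = All.map (λ {z} → at z) (All.¬Any⇒All¬ (vars a) free)
      where
      at : ∀ z → ¬ IsLookback z → env (σ 0) (σ 0) z ≡ past ρ (σ 0) z
      at (now _)    _  = refl
      at (before _) ¬l = contradiction tt ¬l

  -- At instant 0 atoms with lookback variables hold, whereas Win(s₀) evaluates
  -- them under an arbitrary ρ; by well-formedness this makes no difference.
  run-truth : WellFormed ψ → ∀ ρ σ k →
    run ⟪ s₀ ⟫ (truthᵗ σ) 0 k ≗ run ⟪ s₀ ⟫ (truthʳ ρ σ) 0 k
  run-truth wf ρ σ zero    v = refl
  run-truth wf ρ σ (suc k) = run-cong 1 k (determined-step (truthᵗ σ 0) determined-s₀) first later
    where
    first : step (truthᵗ σ 0) ⟪ s₀ ⟫ ≗ step (truthʳ ρ σ 0) ⟪ s₀ ⟫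
    first v = trans (evalᵖ-back (truthᵗ σ 0) v s₀)
      (trans (back-first wf (truthᵗ-zero ρ σ) v) (sym (evalᵖ-back (truthʳ ρ σ 0) v s₀)))
    later : ∀ j → 1 ℕ.≤ j → AgreeOnAtoms (truthᵗ σ j) (truthʳ ρ σ j)
    later (suc j) _ {a} _ = truthᵗ-suc ρ σ j a

  agent : ∀ i {f ρ} → G i f ρ → Agent-strategy
  respond : ∀ i {f ρ} → Final f ⊎ (∀ β → Reply i f ρ β) → Vec ℤ m → Agent-strategy
  agent zero    p _        = replicate n (+ 0)
  agent (suc i) p []       = replicate n (+ 0)
  agent (suc i) p (β ∷ βs) = respond i (unroll i p) β βs
  respond i (inj₁ _)     β _         = replicate n (+ 0)
  respond i (inj₂ reply) β []        = proj₁ (reply β)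
  respond i (inj₂ reply) β (β′ ∷ βs) = agent i (proj₂ (reply β)) (β′ ∷ βs)

  agent-wins : ∀ k i {f ρ} (p : G i f ρ) π →
    let σ = play (agent i p) π; f′ = run f (truthʳ ρ σ) 0 in
    (∀ j → j ℕ.≤ k → ¬ Final (f′ j)) → G (i ∸ suc k) (f′ (suc k)) (value (σ k))
  respond-wins : ∀ k i {f ρ} (u : Final f ⊎ (∀ β → Reply i f ρ β)) π →
    let σ = λ j → π j , respond i u (π 0) (prefix (π ∘ suc) j); f′ = run f (truthʳ ρ σ) 0 in
    (∀ j → j ℕ.≤ k → ¬ Final (f′ j)) → G (i ∸ k) (f′ (suc k)) (value (σ k))
  agent-wins k zero    p π ¬final = contradiction p (¬final 0 z≤n)
  agent-wins k (suc i) p π ¬final = respond-wins k i (unroll i p) π ¬final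
  respond-wins k       i (inj₁ final) π ¬final = contradiction final (¬final 0 z≤n)
  respond-wins zero    i (inj₂ reply) π ¬final = proj₂ (reply (π 0))
  respond-wins (suc k) i {f} {ρ} (inj₂ reply) π ¬final =
    subst (λ f′ → G (i ∸ suc k) f′ (value (σ (suc k)))) (sym (run-shift f₁ (truthʳ ρ σ) 0 (suc k)))
      (agent-wins k i (proj₂ (reply (π 0))) (π ∘ suc) λ j j≤k final →
        ¬final (suc j) (s≤s j≤k) (subst Final (sym (run-shift f₁ (truthʳ ρ σ) 0 j)) final))
    where
    σ = λ j → π j , respond i (inj₂ reply) (π 0) (prefix (π ∘ suc) j)
    f₁ = step (truthʳ ρ σ 0) f

  winning : WellFormed ψ → ∀ {K ρ} → G (suc K) ⟪ s₀ ⟫ ρ → ∃ (Wins K)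
  winning wf {K} {ρ} p = agent (suc K) p , λ π k ¬final →
    let σ = play (agent (suc K) p) π in
    G-≗ (K ∸ k) (sym ∘ run-truth wf ρ σ (suc k))
      (agent-wins k (suc K) p π λ j j≤k final →
        ¬final j j≤k (final-≗ (sym ∘ run-truth wf ρ σ j) final))

  module _ {K : ℕ} (st : Stable K) where

    module Attack {f : State} {ρ : V m n → ℤ} (det : Determined f) (¬g : ¬ G K f ρ)
                  (h : Agent-strategy) where

      move : ∃[ β ] ¬ Reply K f ρ β
      move = no-reply K det (¬g ∘ st det)

      β : Vec ℤ m
      β = proj₁ move

      γ : Vec ℤ n
      γ = h (β ∷ [])

      det′ : Determined (step (truth ρ (β , γ)) f)
      det′ = determined-step (truth ρ (β , γ)) det

      ¬g′ : ¬ G K (step (truth ρ (β , γ)) f) (value (β , γ))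
      ¬g′ g = proj₂ move (γ , g)

      h′ : Agent-strategy
      h′ βs = h (β ∷ βs)

    adversary : ∀ {f ρ} → Determined f → ¬ G K f ρ → Agent-strategy → Env-strategy
    adversary det ¬g h zero    = Attack.β det ¬g h
    adversary det ¬g h (suc i) =
      adversary (Attack.det′ det ¬g h) (Attack.¬g′ det ¬g h) (Attack.h′ det ¬g h) i

    adversary-escapes : ∀ k {f ρ} (det : Determined f) (¬g : ¬ G K f ρ) h →
      let σ = play h (adversary det ¬g h) in ¬ Final (run f (truthʳ ρ σ) 0 k)
    adversary-escapes zero    det ¬g h final = ¬g (G-mono z≤n final)
    adversary-escapes (suc k) {f} {ρ} det ¬g h final =
      adversary-escapes k (Attack.det′ det ¬g h) (Attack.¬g′ det ¬g h) (Attack.h′ det ¬g h)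
        (subst Final (run-shift (step (truthʳ ρ σ 0) f) (truthʳ ρ σ) 0 k) final)
      where
      σ = play h (adversary det ¬g h)

    realizable⇒winnable : WellFormed ψ → Realizable ψ → ∃[ ρ ] G K ⟪ s₀ ⟫ ρ
    realizable⇒winnable wf (h , realizes) = decidable-stable (∃G? K determined-s₀) λ none →
      let ρ     = λ _ → + 0
          ¬g    = λ g → none (ρ , g)
          π     = adversary determined-s₀ ¬g h
          k , ⊨ψ = realizes π
      in adversary-escapes (suc k) determined-s₀ ¬g h
           (final-≗ (run-truth wf ρ (play h π) (suc k)) (Equivalence.to (⊨⇔final (play h π) k) ⊨ψ))

  winnable⇒realizable : WellFormed ψ → ∀ {K ρ} → G K ⟪ s₀ ⟫ ρ → Realizable ψ
  winnable⇒realizable wf {K} p = let h , wins = winning wf (inj₁ p) in h , wins-realizes {K} h wins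

  realizable? : WellFormed ψ → Dec (Realizable ψ)
  realizable? wf with stable
  ... | K , st = map′ (λ (_ , p) → winnable⇒realizable wf p) (realizable⇒winnable st wf)
    (∃G? K determined-s₀)

-- The AND-OR-graph

⟦⟧ᶠ-map : ∀ {A B} {f : A → B} {P : B → Set} {Q : A → Set} → (∀ a → P (f a) ⇔ Q a) →
  ∀ φ → ⟦ mapᶠ f φ ⟧ᶠ P ⇔ ⟦ φ ⟧ᶠ Q
⟦⟧ᶠ-map e (const true)  = ⇔-id _
⟦⟧ᶠ-map e (const false) = ⇔-id _
⟦⟧ᶠ-map e (lit true a)  = e a
⟦⟧ᶠ-map e (lit false a) = ¬-cong-⇔ (e a)
⟦⟧ᶠ-map e (φ ∧ χ)       = ⟦⟧ᶠ-map e φ ×-⇔ ⟦⟧ᶠ-map e χ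
⟦⟧ᶠ-map e (φ ∨ χ)       = ⟦⟧ᶠ-map e φ ⊎-⇔ ⟦⟧ᶠ-map e χ

⟦⟧-rename : ∀ {Γ Δ} (f : Γ → Δ) φ {ρ : Δ → ℤ} {ρ′ : Γ → ℤ} → (∀ x → ρ (f x) ≡ ρ′ x) →
  ⟦ rename f φ ⟧ ρ ⇔ ⟦ φ ⟧ ρ′
⟦⟧-rename f (qf φ) {ρ} eq = ⟦⟧ᶠ-map
  (λ a → mk⇔ (⟦⟧ᵃ-cong a (All.universal eq (vars a)) ∘ Equivalence.to (⟦⟧ᵃ-map f a ρ))
             (Equivalence.from (⟦⟧ᵃ-map f a ρ) ∘ ⟦⟧ᵃ-cong a (All.universal (sym ∘ eq) (vars a)))) φ
⟦⟧-rename f (φ ∧ χ) eq = ⟦⟧-rename f φ eq ×-⇔ ⟦⟧-rename f χ eq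
⟦⟧-rename f (φ ∨ χ) eq = ⟦⟧-rename f φ eq ⊎-⇔ ⟦⟧-rename f χ eq
⟦⟧-rename f (φ ⇒ χ) eq = →-cong-⇔ (⟦⟧-rename f φ eq) (⟦⟧-rename f χ eq)
⟦⟧-rename f (∀ᵇ k φ) {ρ} {ρ′} eq = mk⇔
  (λ h xs → Equivalence.to (⟦⟧-rename (lift f) φ (lifted xs)) (h xs))
  (λ h xs → Equivalence.from (⟦⟧-rename (lift f) φ (lifted xs)) (h xs))
  where
  lifted : ∀ xs z → extend ρ xs (lift f z) ≡ extend ρ′ xs z
  lifted xs (inj₁ z) = eq z
  lifted xs (inj₂ i) = refl
⟦⟧-rename f (∃ᵇ k φ) {ρ} {ρ′} eq = mk⇔
  (λ (xs , h) → xs , Equivalence.to (⟦⟧-rename (lift f) φ (lifted xs)) h)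
  (λ (xs , h) → xs , Equivalence.from (⟦⟧-rename (lift f) φ (lifted xs)) h)
  where
  lifted : ∀ xs z → extend ρ xs (lift f z) ≡ extend ρ′ xs z
  lifted xs (inj₁ z) = eq z
  lifted xs (inj₂ i) = refl

⟦⋁⟧ : ∀ {A : Set} {Γ} (f : A → Form Γ) xs {ρ} → ⟦ ⋁ (map f xs) ⟧ ρ ⇔ Any (λ x → ⟦ f x ⟧ ρ) xs
⟦⋁⟧ f []       = mk⇔ (λ ()) (λ ())
⟦⋁⟧ f (x ∷ xs) = mk⇔ [ here , there ∘ Equivalence.to (⟦⋁⟧ f xs) ]′
  λ { (here p) → inj₁ p ; (there p) → inj₂ (Equivalence.from (⟦⋁⟧ f xs) p) }

⟦⋀⟧ : ∀ {A : Set} {Γ} (f : A → Form Γ) xs {ρ} → ⟦ ⋀ (map f xs) ⟧ ρ ⇔ All (λ x → ⟦ f x ⟧ ρ) xs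
⟦⋀⟧ f []       = mk⇔ (λ _ → []) (λ _ → tt)
⟦⋀⟧ f (x ∷ xs) = mk⇔ (λ (p , ps) → p ∷ Equivalence.to (⟦⋀⟧ f xs) ps)
  λ { (p ∷ ps) → p , Equivalence.from (⟦⋀⟧ f xs) ps }

if-no : ∀ {P A : Set} (P? : Dec P) {x y : A} → ¬ P → (if does P? then x else y) ≡ y
if-no (yes p) ¬p = contradiction p ¬p
if-no (no _)  _  = refl

if-∈ : ∀ {P A : Set} (P? : Dec P) {x : A} {xs} → x ∈ (if does P? then [] else xs) → x ∈ xs
if-∈ (no _) x∈ = x∈

⟦if⟧ : ∀ {P Γ : Set} (P? : Dec P) {ρ : Γ → ℤ} →
  ⟦ if does P? then qf (const true) else qf (const false) ⟧ ρ ⇔ P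
⟦if⟧ (yes p) = mk⇔ (λ _ → p) (λ _ → tt)
⟦if⟧ (no ¬p) = mk⇔ (λ ()) ¬p

module Graph {m n : ℕ} (D : Decomposition m n) (ψ : IPCProperty m n) where

  open Semantics ψ
  open Decomposition D
  open AO D ψ using (andEdges; orEdges; final?; Pre; Pre′; Win; Strategy)

  agent-values : (V m n → ℤ) → Vec ℤ n
  agent-values ρ = tabulate (ρ ∘ inj₂)

  ⟦_⟧ᵖ : FO Atom → (V m n → ℤ) → Assignment m n → Set
  ⟦ φ ⟧ᵖ ρ α = ⟦ φ ⟧ᶠ (λ a → ⟦ a ⟧ᵃ (past ρ α))

  ⟦Pre′⟧ : ∀ 𝓒 t ρ β γ₀ → ⟦ Pre′ 𝓒 t ⟧ (past ρ (β , γ₀)) ⇔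
    Any (λ (ς , u) → ∃[ γ ] ⟦ ς ⟧ᵖ ρ (β , γ) × ⟦ 𝓒 u ⟧ (value (β , γ))) (orEdges t)
  ⟦Pre′⟧ 𝓒 t ρ β γ₀ = mk⇔ (Any.map (λ {e} → to {e}) ∘ Equivalence.to (⟦⋁⟧ _ (orEdges t)))
                          (Equivalence.from (⟦⋁⟧ _ (orEdges t)) ∘ Any.map (λ {e} → from {e}))
    where
    bound : ∀ γ z → extend (past ρ (β , γ₀)) γ (bindY z) ≡ past ρ (β , γ) z
    bound γ (now (inj₁ _)) = refl
    bound γ (now (inj₂ _)) = refl
    bound γ (before _)     = refl
    edge : ∀ ς u γ → ⟦ rename bindY (qf ς ∧ rename now (𝓒 u)) ⟧ (extend (past ρ (β , γ₀)) γ) ⇔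
                     (⟦ ς ⟧ᵖ ρ (β , γ) × ⟦ 𝓒 u ⟧ (value (β , γ)))
    edge ς u γ = ⟦⟧-rename bindY (qf ς) (bound γ) ×-⇔
      (⟦⟧-rename inj₁ (𝓒 u) (λ _ → refl) ⇔-∘ ⟦⟧-rename bindY (rename now (𝓒 u)) (bound γ))
    to : ∀ {e : Part m n} → let ς , u = e in ⟦ ∃Y (qf ς ∧ rename now (𝓒 u)) ⟧ (past ρ (β , γ₀)) →
      ∃[ γ ] ⟦ ς ⟧ᵖ ρ (β , γ) × ⟦ 𝓒 u ⟧ (value (β , γ))
    to {ς , u} (γ , h) = γ , Equivalence.to (edge ς u γ) h
    from : ∀ {e : Part m n} → let ς , u = e in ∃[ γ ] ⟦ ς ⟧ᵖ ρ (β , γ) × ⟦ 𝓒 u ⟧ (value (β , γ)) →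
      ⟦ ∃Y (qf ς ∧ rename now (𝓒 u)) ⟧ (past ρ (β , γ₀))
    from {ς , u} (γ , h) = γ , Equivalence.from (edge ς u γ) h

  EdgeWins : (Label m n → Form (V m n)) → (V m n → ℤ) → Part m n → Set
  EdgeWins 𝓒 ρ (w , t) = ∀ β → ⟦ w ⟧ᵖ ρ (β , agent-values ρ) →
    Any (λ (ς , u) → ∃[ γ ] ⟦ ς ⟧ᵖ ρ (β , γ) × ⟦ 𝓒 u ⟧ (value (β , γ))) (orEdges t)

  ⟦Pre⟧ : ∀ 𝓒 s ρ → ⟦ Pre 𝓒 s ⟧ ρ ⇔ All (EdgeWins 𝓒 ρ) (andEdges s)
  ⟦Pre⟧ 𝓒 s ρ = mk⇔
    (All.map (λ {e} h β w → Equivalence.to (⟦Pre′⟧ 𝓒 (proj₂ e) ρ β (agent-values ρ))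
      (Equivalence.to (edge e β) (h β) w)) ∘ Equivalence.to (⟦⋀⟧ _ (andEdges s)))
    (Equivalence.from (⟦⋀⟧ _ (andEdges s)) ∘ All.map (λ {e} h β → Equivalence.from (edge e β)
      λ w → Equivalence.from (⟦Pre′⟧ 𝓒 (proj₂ e) ρ β (agent-values ρ)) (h β w)))
    where
    bound : ∀ β z → extend ρ β (lift unprime (bindX z)) ≡ past ρ (β , agent-values ρ) z
    bound β (now (inj₁ _)) = refl
    bound β (now (inj₂ y)) = sym (Vec.lookup∘tabulate (ρ ∘ inj₂) y)
    bound β (before _)     = refl
    edge : ∀ (e : Part m n) β → let w , t = e; φ = qf w ⇒ Pre′ 𝓒 t in
      ⟦ rename (lift unprime) (rename bindX φ) ⟧ (extend ρ β) ⇔ ⟦ φ ⟧ (past ρ (β , agent-values ρ))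
    edge (w , t) β = ⟦⟧-rename bindX (qf w ⇒ Pre′ 𝓒 t) (bound β) ⇔-∘
      ⟦⟧-rename (lift unprime) (rename bindX (qf w ⇒ Pre′ 𝓒 t)) (λ _ → refl)

  Final⇔ : ∀ (s : Label m n) → AO.Final D ψ s ⇔ Final ⟪ s ⟫
  Final⇔ s = mk⇔
    (λ final v eq → subst (λ b → not b ∨ᵇ evalᵖ v s ≡ true) eq (final v))
    from
    where
    from : Final ⟪ s ⟫ → AO.Final D ψ s
    from final v with v (atomᵖ last) in eq
    ... | false = refl
    ... | true  = final v eq

  valid? : ∀ (s : Label m n) → Dec (s ≈ ⊤ᵖ)
  valid? s = s ≈⊤?

  valid⇒final : ∀ (s : Label m n) → s ≈ ⊤ᵖ → Final ⟪ s ⟫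
  valid⇒final s valid v _ = valid v

  andEdges-≡ : ∀ (s : Label m n) → ¬ (s ≈ ⊤ᵖ) → andEdges s ≡ decomp (xnf s) C-env
  andEdges-≡ s = if-no (s ≈⊤?)

  andEdges-∈ : ∀ s {e} → e ∈ andEdges s → e ∈ decomp (xnf s) C-env
  andEdges-∈ s = if-∈ (s ≈⊤?)

  env-decomp : ∀ s → IsDecomposition (xnf s) C-env (decomp (xnf s) C-env)
  env-decomp s = isDecomposition (xnf s) C-env (xnf-XNF s)

  ag-decomp : ∀ t → IsDecomposition (xnf t) C-ag (decomp (xnf t) C-ag)
  ag-decomp t = isDecomposition (xnf t) C-ag (xnf-XNF t)

  record Round (s : Label m n) (I : Atom → Bool) (u : Label m n) : Set where
    field
      {w}    : FO Atom
      {t}    : Label m n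
      {ς}    : FO Atom
      and-∈  : (w , t) ∈ andEdges s
      w-true : evalᶠ I w ≡ true
      or-∈   : (ς , u) ∈ orEdges t
      ς-true : evalᶠ I ς ≡ true

  round-≗ : ∀ {s I u} → Round s I u → ⟪ u ⟫ ≗ step I ⟪ s ⟫
  round-≗ {s} {I} r v with ∈-map⁻ _ (Round.or-∈ r)
  ... | p , p∈ , refl = trans
    (evalᵖ-successor I v {s} (env-decomp s) (andEdges-∈ s (Round.and-∈ r)) (Round.w-true r)
      (ag-decomp (Round.t r)) p∈ (Round.ς-true r))
    (sym (evalᵖ-back I v s))

  orEdge : ∀ t I → ∃[ ς ] ∃[ u ] (ς , u) ∈ orEdges t × evalᶠ I ς ≡ true
  orEdge t I = let (ς , u) , p∈ , eq = some-guard (ag-decomp t) I in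
    ς , xnf (rmX u) , ∈-map⁺ _ p∈ , eq

  next-round : ∀ s I → ¬ (s ≈ ⊤ᵖ) → ∃ (Round s I)
  next-round s I ¬valid =
    let (w , t) , e∈ , w-true = some-guard (env-decomp s) I
        ς , u , or-∈ , ς-true = orEdge t I
    in u , record
      { and-∈ = subst ((w , t) ∈_) (sym (andEdges-≡ s ¬valid)) e∈ ; w-true = w-true
      ; or-∈ = or-∈ ; ς-true = ς-true }

  truth-reflects : ∀ ρ α φ → Reflects (⟦ φ ⟧ᵖ ρ α) (evalᶠ (truth ρ α) φ)
  truth-reflects ρ α = evalᶠ-reflects (λ a → proof (⟦ a ⟧ᵃ? (past ρ α)))

  ⟦⟧ᵖ⇔true : ∀ ρ α φ → ⟦ φ ⟧ᵖ ρ α ⇔ evalᶠ (truth ρ α) φ ≡ true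
  ⟦⟧ᵖ⇔true ρ α φ = reflects-true (truth-reflects ρ α φ)

  guard-agent-free : ∀ s {w t} ρ β γ γ′ → (w , t) ∈ andEdges s →
    evalᶠ (truth ρ (β , γ)) w ≡ evalᶠ (truth ρ (β , γ′)) w
  guard-agent-free s {w} ρ β γ γ′ e∈ = evalᶠ-cong w
    (All.map same (All.lookup (IsDecomposition.prm-over-C (env-decomp s)) (andEdges-∈ s e∈)))
    where
    at : ∀ z → ¬ IsAgent z → past ρ (β , γ) z ≡ past ρ (β , γ′) z
    at (now (inj₁ _)) _   = refl
    at (now (inj₂ _)) ¬ag = contradiction tt ¬ag
    at (before _)     _   = refl
    same : ∀ {a} → a ∈ C-env → truth ρ (β , γ) a ≡ truth ρ (β , γ′) a
    same {a} a∈ = does-⇔ (mk⇔ (⟦⟧ᵃ-cong a eqs) (⟦⟧ᵃ-cong a (All.map sym eqs)))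
      (⟦ a ⟧ᵃ? _) (⟦ a ⟧ᵃ? _)
      where
      eqs : All (λ z → past ρ (β , γ) z ≡ past ρ (β , γ′) z) (vars a)
      eqs = All.map (λ {z} → at z) (All.¬Any⇒All¬ (vars a)
        (proj₂ (∈-filter⁻ (λ a → ¬? (any? isAgent? (vars a))) {xs = atomsᵖ ψ} a∈)))

  Win⇔G : ∀ i s ρ → ⟦ Win i s ⟧ ρ ⇔ G i ⟪ s ⟫ ρ
  Win⇔G zero s ρ = Final⇔ s ⇔-∘ ⟦if⟧ (final? s)
  Win⇔G (suc i) s ρ = mk⇔ to from
    where
    to : ⟦ Win (suc i) s ⟧ ρ → G (suc i) ⟪ s ⟫ ρ
    to (inj₁ win) = inj₁ (Equivalence.to (Win⇔G i s ρ) win)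
    to (inj₂ pre) with valid? s
    ... | yes valid = G-mono z≤n (valid⇒final s valid)
    ... | no ¬valid = inj₂ reply
      where
      reply : ∀ β → Reply i ⟪ s ⟫ ρ β
      reply β =
        let γ₀    = agent-values ρ
            _ , r = next-round s (truth ρ (β , γ₀)) ¬valid
            open Round r
            w-holds = Equivalence.from (⟦⟧ᵖ⇔true ρ (β , γ₀) w) w-true
            (ς , u) , or-∈ , γ , ς-holds , win =
              find (All.lookup (Equivalence.to (⟦Pre⟧ (Win i) s ρ) pre) and-∈ β w-holds)
            round = record
              { and-∈  = and-∈
              ; w-true = trans (guard-agent-free s ρ β γ γ₀ and-∈) w-true
              ; or-∈   = or-∈
              ; ς-true = Equivalence.to (⟦⟧ᵖ⇔true ρ (β , γ) ς) ς-holds }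
        in γ , G-≗ i (round-≗ round) (Equivalence.to (Win⇔G i u (value (β , γ))) win)
    from : G (suc i) ⟪ s ⟫ ρ → ⟦ Win (suc i) s ⟧ ρ
    from (inj₁ g)     = inj₁ (Equivalence.from (Win⇔G i s ρ) g)
    from (inj₂ reply) = inj₂ (Equivalence.from (⟦Pre⟧ (Win i) s ρ) (All.tabulate edge-wins))
      where
      edge-wins : ∀ {e} → e ∈ andEdges s → EdgeWins (Win i) ρ e
      edge-wins {w , t} e∈ β w-holds =
        let γ , g = reply β
            ς , u , or-∈ , ς-true = orEdge t (truth ρ (β , γ))
            round = record
              { and-∈  = e∈
              ; w-true = trans (guard-agent-free s ρ β γ (agent-values ρ) e∈)
                           (Equivalence.to (⟦⟧ᵖ⇔true ρ _ w) w-holds)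
              ; or-∈   = or-∈
              ; ς-true = ς-true }
        in lose or-∈ (γ , Equivalence.from (⟦⟧ᵖ⇔true ρ _ ς) ς-true ,
             Equivalence.from (Win⇔G i u _) (G-≗ i (sym ∘ round-≗ round) g))

  successor : ∀ s I → ∃[ u ] (⟪ u ⟫ ≗ step I ⟪ s ⟫) × (¬ (s ≈ ⊤ᵖ) → Round s I u)
  successor s I with valid? s
  ... | yes valid = s , (λ v → trans (valid v) (sym (valid (back I v)))) , contradiction valid
  ... | no ¬valid = let u , r = next-round s I ¬valid in u , round-≗ r , λ _ → r

  truth-after : Maybe (Assignment m n) → Assignment m n → Atom → Bool
  truth-after p α a = does (holds? p α a)

  node : Maybe (Assignment m n) → Agent-strategy → Label m n → List (Vec ℤ m) → Label m n
  node p h s []       = s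
  node p h s (β ∷ βs) = node (just α) (h ∘ (β ∷_)) (proj₁ (successor s (truth-after p α))) βs
    where α = β , h (β ∷ [])

  previous-from : Maybe (Assignment m n) → (ℕ → Assignment m n) → ℕ → Maybe (Assignment m n)
  previous-from p σ zero    = p
  previous-from p σ (suc k) = previous-from (just (σ 0)) (σ ∘ suc) k

  truth-from : Maybe (Assignment m n) → (ℕ → Assignment m n) → ℕ → Atom → Bool
  truth-from p σ k = truth-after (previous-from p σ k) (σ k)

  truth-from-nothing : ∀ σ k → truth-from nothing σ k ≡ truthᵗ σ k
  truth-from-nothing σ k = cong (λ p → truth-after p (σ k)) (start k)
    where
    later : ∀ σ k → previous-from (just (σ 0)) (σ ∘ suc) k ≡ just (σ k)
    later σ zero    = refl
    later σ (suc k) = later (σ ∘ suc) k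
    start : ∀ k → previous-from nothing σ k ≡ previous σ k
    start zero    = refl
    start (suc k) = later σ k

  node-round : ∀ k p h s π → let s′ = node p h s (prefix π k) in ¬ (s′ ≈ ⊤ᵖ) →
    Round s′ (truth-from p (play h π) k) (node p h s (prefix π (suc k)))
  node-round zero    p h s π ¬valid = proj₂ (proj₂ (successor s (truth-from p (play h π) 0))) ¬valid
  node-round (suc k) p h s π ¬valid =
    node-round k (just (play h π 0)) (h ∘ (π 0 ∷_)) _ (π ∘ suc) ¬valid

  run-≗ : ∀ {f f′} I i k → f ≗ f′ → run f I i k ≗ run f′ I i k
  run-≗ I i zero    eq = eq
  run-≗ I i (suc k) eq = run-≗ I (suc i) k (step-≗ (I i) eq)

  node-≗ : ∀ k p h s π →
    ⟪ node p h s (prefix π k) ⟫ ≗ run ⟪ s ⟫ (truth-from p (play h π)) 0 k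
  node-≗ zero    p h s π v = refl
  node-≗ (suc k) p h s π v = trans
    (node-≗ k (just (play h π 0)) (h ∘ (π 0 ∷_)) (proj₁ next) (π ∘ suc) v)
    (trans (run-≗ (I ∘ suc) 0 k (proj₁ (proj₂ next)) v)
      (cong (λ f → f v) (sym (run-shift (step (I 0) ⟪ s ⟫) I 0 k))))
    where
    I = truth-from p (play h π)
    next = successor s (I 0)

  run-suc : ∀ f I i k → run f I i (suc k) ≡ step (I (i + k)) (run f I i k)
  run-suc f I i zero    rewrite ℕ.+-identityʳ i = refl
  run-suc f I i (suc k) rewrite ℕ.+-suc i k = run-suc (step (I i) f) I (suc i) k

  holds-reflects : ∀ σ k φ → Reflects (⟦ φ ⟧ᶠ (holds (previous σ k) (σ k))) (evalᶠ (truthᵗ σ k) φ)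
  holds-reflects σ k = evalᶠ-reflects (λ a → proof (holds? (previous σ k) (σ k) a))

  wins⇒strategy : ∀ {K} h → Wins K h → Strategy K
  wins⇒strategy {K} h wins = record
    { g     = h
    ; node  = node nothing h s₀
    ; start = refl
    ; step  = λ π k ¬final →
        let σ  = play h π
            s  = node nothing h s₀ (prefix π k)
            u  = node nothing h s₀ (prefix π (suc k))
            r  = subst (λ I → Round s I u) (truth-from-nothing σ k)
                   (node-round k nothing h s₀ π λ valid → ¬final k ℕ.≤-refl
                     (Equivalence.from (Final⇔ s) (valid⇒final s valid)))
            node≗ = λ j v → trans (node-≗ j nothing h s₀ π v)
              (run-cong 0 j determined-s₀ (λ _ → refl)
                (λ i _ {a} _ → cong (λ I → I a) (truth-from-nothing σ i)) v)
            win = wins π k λ j j≤k final → ¬final j j≤k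
              (Equivalence.from (Final⇔ (node nothing h s₀ (prefix π j)))
                (final-≗ (sym ∘ node≗ j) final))
            open Round r
        in (w , t) , (ς , u) , and-∈ ,
           Equivalence.from (reflects-true (holds-reflects σ k w)) w-true , or-∈ ,
           Equivalence.from (reflects-true (holds-reflects σ k ς)) ς-true ,
           Equivalence.from (Win⇔G (K ∸ k) u (value (σ k)))
             (G-≗ (K ∸ k) (sym ∘ node≗ (suc k)) win) ,
           refl
    }

  module _ {K : ℕ} (S : Strategy K) (π : Env-strategy) where

    private
      open Strategy S using (g; start) renaming (node to label; step to follow)

      σ : ℕ → Assignment m n
      σ = play g π

      state : ℕ → State
      state = run ⟪ s₀ ⟫ (truthᵗ σ) 0

      LegalStep : ℕ → Set
      LegalStep k = Round (label (prefix π k)) (truthᵗ σ k) (label (prefix π (suc k))) ×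
        ⟦ Win (K ∸ k) (label (prefix π (suc k))) ⟧ (value (σ k))

      legal : ∀ k → (∀ j → j ℕ.≤ k → ¬ AO.Final D ψ (label (prefix π j))) → LegalStep k
      legal k ¬final with follow π k ¬final
      ... | (w , t) , (ς , u) , and-∈ , w-holds , or-∈ , ς-holds , win , eq =
        record
          { and-∈  = and-∈
          ; w-true = Equivalence.to (reflects-true (holds-reflects σ k w)) w-holds
          ; or-∈   = subst (λ u → (ς , u) ∈ orEdges t) (sym eq) or-∈
          ; ς-true = Equivalence.to (reflects-true (holds-reflects σ k ς)) ς-holds } ,
        subst (λ u → ⟦ Win (K ∸ k) u ⟧ (value (σ k))) (sym eq) win

      label-≗ : ∀ k → (∀ j → j ℕ.< k → ¬ Final (state j)) →
        ∀ j → j ℕ.≤ k → ⟪ label (prefix π j) ⟫ ≗ state j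

      legal-state : ∀ k → (∀ j → j ℕ.≤ k → ¬ Final (state j)) → LegalStep k
      legal-state k ¬final = legal k λ j j≤k final → ¬final j j≤k
        (final-≗ (label-≗ k (λ j j<k → ¬final j (ℕ.<⇒≤ j<k)) j j≤k)
          (Equivalence.to (Final⇔ (label (prefix π j))) final))

      label-≗ zero    ¬final zero z≤n v = cong (evalᵖ v) start
      label-≗ (suc k) ¬final j j≤k with ℕ.m≤n⇒m<n∨m≡n j≤k
      ... | inj₁ j<k  = label-≗ k (λ i i<k → ¬final i (ℕ.m≤n⇒m≤1+n i<k)) j (ℕ.≤-pred j<k)
      ... | inj₂ refl = λ v → trans (round-≗ (proj₁ (legal-state k λ i i≤k → ¬final i (s≤s i≤k))) v)
        (trans (step-≗ (truthᵗ σ k)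
                 (label-≗ k (λ i i<k → ¬final i (ℕ.m≤n⇒m≤1+n i<k)) k ℕ.≤-refl) v)
          (cong (λ f → f v) (sym (run-suc ⟪ s₀ ⟫ (truthᵗ σ) 0 k))))

    legal-G : ∀ k → (∀ j → j ℕ.≤ k → ¬ Final (state j)) → G (K ∸ k) (state (suc k)) (value (σ k))
    legal-G k ¬final =
      G-≗ (K ∸ k) (label-≗ (suc k) (λ j j<k → ¬final j (ℕ.≤-pred j<k)) (suc k) ℕ.≤-refl)
        (Equivalence.to (Win⇔G (K ∸ k) _ (value (σ k))) (proj₂ (legal-state k ¬final)))

  strategy⇒wins : ∀ {K} (S : Strategy K) → Wins K (Strategy.g S)
  strategy⇒wins = legal-G

theorem5 : ∀ {m n : ℕ} .{{_ : NonZero (m + n)}} (ψ : IPCProperty m n) → WellFormed ψ →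
    Dec (Realizable ψ) ×
    (∀ (D : Decomposition m n) → let open AO D ψ in
    (∃[ K ] (Win K s₀ ≋ Win (suc K) s₀) ×
    (∀ ρ → Win-AO ρ ⇔ ⟦ Win K s₀ ⟧ ρ) ×
    Dec (Satisfiable (Win K s₀)) ×
    (Realizable ψ ⇔ Satisfiable (Win K s₀))) ×
    (∀ K → Win K s₀ ≋ Win (suc K) s₀ → Satisfiable (Win K s₀) →
    Strategy K × (∀ (G : Strategy K) → Realizes (Strategy.g G) ψ)))
theorem5 {m} {n} ψ wf = realizable? wf , λ D → fixpoint D , strategies D
  where
  open Semantics ψ

  module _ (D : Decomposition m n) where
    open Graph D ψ using (Win⇔G; wins⇒strategy; strategy⇒wins)
    open AO D ψ using (Win; Win-AO; Strategy)

    module _ (K : ℕ) where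

      Sat⇔G : Satisfiable (Win K s₀) ⇔ (∃[ ρ ] G K ⟪ s₀ ⟫ ρ)
      Sat⇔G = mk⇔ (λ (ρ , w) → ρ , Equivalence.to (Win⇔G K s₀ ρ) w)
                  (λ (ρ , g) → ρ , Equivalence.from (Win⇔G K s₀ ρ) g)

      absorb-Win : Stable K → ∀ i ρ → ⟦ Win i s₀ ⟧ ρ → ⟦ Win K s₀ ⟧ ρ
      absorb-Win st i ρ = Equivalence.from (Win⇔G K s₀ ρ) ∘ absorb st i determined-s₀ ∘
                      Equivalence.to (Win⇔G i s₀ ρ)

    fixpoint : ∃[ K ] (Win K s₀ ≋ Win (suc K) s₀) ×
      (∀ ρ → Win-AO ρ ⇔ ⟦ Win K s₀ ⟧ ρ) ×
      Dec (Satisfiable (Win K s₀)) ×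
      (Realizable ψ ⇔ Satisfiable (Win K s₀))
    fixpoint with stable
    ... | K , st = K ,
      (λ ρ → mk⇔ inj₁ (absorb-Win K st (suc K) ρ)) ,
      (λ ρ → mk⇔ (λ (i , w) → absorb-Win K st i ρ w) (K ,_)) ,
      map′ (Equivalence.from (Sat⇔G K)) (Equivalence.to (Sat⇔G K)) (∃G? K determined-s₀) ,
      mk⇔ (Equivalence.from (Sat⇔G K) ∘ realizable⇒winnable st wf)
          (λ sat → winnable⇒realizable wf (proj₂ (Equivalence.to (Sat⇔G K) sat)))

    strategies : ∀ K → Win K s₀ ≋ Win (suc K) s₀ → Satisfiable (Win K s₀) →
      Strategy K × (∀ (S : Strategy K) → Realizes (Strategy.g S) ψ)
    strategies K _ sat =
      let _ , g = Equivalence.to (Sat⇔G K) sat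
          h , wins = winning wf (inj₁ g)
      in wins⇒strategy h wins , λ S → wins-realizes {K} (Strategy.g S) (strategy⇒wins S)
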